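{- Fix a constant $c>1$. In the semi-oblivious cup flushing game with multiplicative error factor $c$ on $n$ cups, the greedy algorithm achieves worst-case backlog $e^{O(\sqrt{\log n})}$ as $n\to\infty$ (with implied constant allowed to depend on $c$).
   Context: Semi-oblivious cup flushing game (multiplicative error factor $c>1$). There are $n$ cups, initially empty; heights are nonnegative reals. Time proceeds in discrete steps. In each step the adversary first distributes $1$ unit of water among the cups arbitrarily (nonnegative amounts summing to $1$), resulting in intermediate heights $g_1(t),\dots,g_n(t)$. The adversary then shows the player estimates $g_i'(t)\in[g_i(t),\,c\,g_i(t)]$ for each cup $i$, of the adversary's choice. The player then selects one cup and empties it entirely: the selected cup's height becomes $0$, and all other heights are unchanged. The adversary may be adaptive. Greedy algorithm: the player always selects a cup $i$ with maximal estimate $g_i'(t)$, ties broken arbitrarily. Backlog: the supremum over all time steps (including the intermediate moment after the adversary's move) of the height of the fullest cup. Worst-case backlog: the supremum of the backlog over all adversary strategies (water distributions, estimates) and tie-breaking choices. -}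

module Defs where

open import Data.Nat as ℕ using (ℕ; zero; suc)
import Data.Nat.Properties as ℕ
open import Data.Nat.Coprimality using (1-coprimeTo)
open import Data.Integer as ℤ using (+_; -[1+_])
import Data.Integer.Properties as ℤ
open import Data.Rational
open import Data.Rational.Properties
open import Data.Rational.Literals using (fromℤ)
import Data.Rational.Unnormalised as ℚᵘ
import Data.Rational.Unnormalised.Properties as ℚᵘ
open import Data.Rational.Solver using (module +-*-Solver)
open import Data.Fin using (Fin)
open import Data.List using (List; []; _∷_)
open import Data.Vec.Functional as Vector using (Vector)
open import Data.Product using (Σ; ∃; ∃-syntax; _×_; _,_; proj₁; proj₂)
open import Data.Sum as Sum using (_⊎_; inj₁; inj₂)
open import Function using (const; id)
open import Relation.Nullary using (¬_; yes; no; contradiction)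
open import Relation.Binary.PropositionalEquality

open +-*-Solver using (solve; con; _:=_; _:+_; _:*_; _:-_; :-_)

------------------------------------------------------------------------
-- Rational arithmetic

fromℕ : ℕ → ℚ
fromℕ n = fromℤ (+ n)

1/suc : ℕ → ℚ
1/suc k = mkℚ (+ 1) k (1-coprimeTo (suc k))

≤⇒0≤- : ∀ {p q} → p ≤ q → 0ℚ ≤ q - p
≤⇒0≤- {p} {q} p≤q = subst (_≤ q - p) (+-inverseʳ p) (+-monoˡ-≤ (- p) p≤q)

0≤-⇒≤ : ∀ {p q} → 0ℚ ≤ q - p → p ≤ q
0≤-⇒≤ {p} {q} h =
  subst₂ _≤_ (+-identityˡ p)
    (solve 2 (λ p q → q :- p :+ p := q) refl p q) (+-monoˡ-≤ p h)

0≤+ : ∀ {p q} → 0ℚ ≤ p → 0ℚ ≤ q → 0ℚ ≤ p + q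
0≤+ = +-mono-≤

0≤* : ∀ {p q} → 0ℚ ≤ p → 0ℚ ≤ q → 0ℚ ≤ p * q
0≤* {p} {q} 0≤p 0≤q =
  nonNegative⁻¹ _ {{nonNeg*nonNeg⇒nonNeg p {{nonNegative 0≤p}} q {{nonNegative 0≤q}}}}

0<* : ∀ {p q} → 0ℚ < p → 0ℚ < q → 0ℚ < p * q
0<* {p} {q} 0<p 0<q =
  positive⁻¹ _ {{pos*pos⇒pos p {{positive 0<p}} q {{positive 0<q}}}}

*-monoˡ : ∀ {p q} r → 0ℚ ≤ r → p ≤ q → p * r ≤ q * r
*-monoˡ r 0≤r = *-monoʳ-≤-nonNeg r {{nonNegative 0≤r}}

*-monoʳ : ∀ {p q} r → 0ℚ ≤ r → p ≤ q → r * p ≤ r * q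
*-monoʳ r 0≤r = *-monoˡ-≤-nonNeg r {{nonNegative 0≤r}}

*-mono : ∀ {p q r s} → 0ℚ ≤ q → 0ℚ ≤ r → p ≤ q → r ≤ s → p * r ≤ q * s
*-mono {q = q} {r = r} 0≤q 0≤r p≤q r≤s =
  ≤-trans (*-monoˡ r 0≤r p≤q) (*-monoʳ q 0≤q r≤s)

≤⇒≯ : ∀ {p q} → p ≤ q → ¬ q < p
≤⇒≯ p≤q q<p = <-irrefl refl (≤-<-trans p≤q q<p)

p≤∣p∣ : ∀ p → p ≤ ∣ p ∣
p≤∣p∣ p with ≤-total 0ℚ p
... | inj₁ 0≤p = ≤-reflexive (sym (0≤p⇒∣p∣≡p 0≤p))
... | inj₂ p≤0 = ≤-trans p≤0 (0≤∣p∣ p)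

∣-∣≤ : ∀ {p q r} → p ≤ q + r → q ≤ p + r → ∣ p - q ∣ ≤ r
∣-∣≤ {p} {q} {r} p≤ q≤ with ∣p∣≡p∨∣p∣≡-p (p - q)
... | inj₁ e = subst (_≤ r) (sym e) (0≤-⇒≤ (subst (0ℚ ≤_)
        (solve 3 (λ p q r → q :+ r :- p := r :- (p :- q)) refl p q r) (≤⇒0≤- p≤)))
... | inj₂ e = subst (_≤ r) (sym e) (0≤-⇒≤ (subst (0ℚ ≤_)
        (solve 3 (λ p q r → p :+ r :- q := r :- (:- (p :- q))) refl p q r) (≤⇒0≤- q≤)))

∣-∣-comm : ∀ p q → ∣ p - q ∣ ≡ ∣ q - p ∣
∣-∣-comm p q = trans
  (cong ∣_∣ (solve 2 (λ p q → p :- q := :- (q :- p)) refl p q)) (∣-p∣≡∣p∣ (q - p))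

≤+∣-∣ : ∀ {p q r} → ∣ p - q ∣ ≤ r → p ≤ q + r
≤+∣-∣ {p} {q} {r} h = subst (_≤ q + r)
  (solve 2 (λ p q → q :+ (p :- q) := p) refl p q)
  (+-monoʳ-≤ q (≤-trans (p≤∣p∣ (p - q)) h))

∣-∣-triangle : ∀ p q r → ∣ p - r ∣ ≤ ∣ p - q ∣ + ∣ q - r ∣
∣-∣-triangle p q r = subst (λ t → ∣ t ∣ ≤ ∣ p - q ∣ + ∣ q - r ∣)
  (solve 3 (λ p q r → p :- q :+ (q :- r) := p :- r) refl p q r)
  (∣p+q∣≤∣p∣+∣q∣ (p - q) (q - r))

0<½ : ∀ {ε} → 0ℚ < ε → 0ℚ < ε * ½
0<½ 0<ε = 0<* 0<ε (positive⁻¹ ½)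

½+½ : ∀ ε → ε * ½ + ε * ½ ≡ ε
½+½ = solve 1 (λ e → e :* con ½ :+ e :* con ½ := e) refl

fromℕ-suc : ∀ n → fromℕ (suc n) ≡ fromℕ n + 1ℚ
fromℕ-suc n = toℚᵘ-injective
  (ℚᵘ.≃-trans (ℚᵘ.*≡* eq) (ℚᵘ.≃-sym (toℚᵘ-homo-+ (fromℕ n) 1ℚ)))
  where
  eq : + suc n ℤ.* + 1 ≡ (+ n ℤ.* + 1 ℤ.+ + 1 ℤ.* + 1) ℤ.* + 1
  eq = cong (ℤ._* + 1) (trans (cong +_ (ℕ.+-comm 1 n))
         (cong (ℤ._+ + 1) (sym (ℤ.*-identityʳ (+ n)))))

fromℕ-+ : ∀ m n → fromℕ m + fromℕ n ≡ fromℕ (m ℕ.+ n)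
fromℕ-+ zero    n = +-identityˡ (fromℕ n)
fromℕ-+ (suc m) n = begin
  fromℕ (suc m) + fromℕ n       ≡⟨ cong (_+ fromℕ n) (fromℕ-suc m) ⟩
  fromℕ m + 1ℚ + fromℕ n        ≡⟨ solve 2 (λ p q → p :+ con 1ℚ :+ q := p :+ q :+ con 1ℚ)
                                     refl (fromℕ m) (fromℕ n) ⟩
  fromℕ m + fromℕ n + 1ℚ        ≡⟨ cong (_+ 1ℚ) (fromℕ-+ m n) ⟩
  fromℕ (m ℕ.+ n) + 1ℚ          ≡⟨ fromℕ-suc (m ℕ.+ n) ⟨
  fromℕ (suc m ℕ.+ n)           ∎
  where open ≡-Reasoning

fromℕ-* : ∀ m n → fromℕ m * fromℕ n ≡ fromℕ (m ℕ.* n)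
fromℕ-* zero    n = *-zeroˡ (fromℕ n)
fromℕ-* (suc m) n = begin
  fromℕ (suc m) * fromℕ n       ≡⟨ cong (_* fromℕ n) (fromℕ-suc m) ⟩
  (fromℕ m + 1ℚ) * fromℕ n      ≡⟨ solve 2 (λ p q → (p :+ con 1ℚ) :* q := q :+ p :* q)
                                     refl (fromℕ m) (fromℕ n) ⟩
  fromℕ n + fromℕ m * fromℕ n   ≡⟨ cong (λ q → fromℕ n + q) (fromℕ-* m n) ⟩
  fromℕ n + fromℕ (m ℕ.* n)     ≡⟨ fromℕ-+ n (m ℕ.* n) ⟩
  fromℕ (suc m ℕ.* n)           ∎
  where open ≡-Reasoning

fromℕ-mono : ∀ {m n} → m ℕ.≤ n → fromℕ m ≤ fromℕ n
fromℕ-mono m≤n = *≤* (ℤ.*-monoʳ-≤-nonNeg (+ 1) (ℤ.+≤+ m≤n))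

0≤fromℕ : ∀ n → 0ℚ ≤ fromℕ n
0≤fromℕ n = fromℕ-mono {0} {n} ℕ.z≤n

0<1/suc : ∀ k → 0ℚ < 1/suc k
0<1/suc k = positive⁻¹ (1/suc k)

0≤1/suc : ∀ k → 0ℚ ≤ 1/suc k
0≤1/suc k = nonNegative⁻¹ (1/suc k)

suc*1/suc : ∀ k → fromℕ (suc k) * 1/suc k ≡ 1ℚ
suc*1/suc k = toℚᵘ-injective
  (ℚᵘ.≃-trans (toℚᵘ-homo-* (fromℕ (suc k)) (1/suc k)) (ℚᵘ.*≡* eq))
  where
  eq : (+ suc k ℤ.* + 1) ℤ.* + 1 ≡ + 1 ℤ.* + (1 ℕ.* suc k)
  eq = trans (ℤ.*-identityʳ (+ suc k ℤ.* + 1))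
      (trans (ℤ.*-identityʳ (+ suc k)) (sym
        (trans (ℤ.*-identityˡ (+ (1 ℕ.* suc k))) (cong +_ (ℕ.*-identityˡ (suc k))))))

1/suc-anti : ∀ {j k} → j ℕ.≤ k → 1/suc k ≤ 1/suc j
1/suc-anti j≤k = *≤* (ℤ.*-monoˡ-≤-nonNeg (+ 1) (ℤ.+≤+ (ℕ.s≤s j≤k)))

archimedean : ∀ p → ∃[ n ] p ≤ fromℕ n
archimedean (mkℚ (+ n) d _) =
  n , *≤* (ℤ.*-monoˡ-≤-nonNeg (+ n) (ℤ.+≤+ (ℕ.s≤s ℕ.z≤n)))
archimedean p@(mkℚ -[1+ n ] _ _) = 0 , <⇒≤ (negative⁻¹ p)

1/suc-small : ∀ p {ε} → 0ℚ < ε → ∃[ k ] p * 1/suc k ≤ ε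
1/suc-small p {ε} 0<ε = k , bound k (proj₂ (archimedean (p * 1/ ε)))
  where
  open ≤-Reasoning
  instance
    ε≢0 : NonZero ε
    ε≢0 = >-nonZero 0<ε
  k : ℕ
  k = proj₁ (archimedean (p * 1/ ε))
  bound : ∀ k → p * 1/ ε ≤ fromℕ k → p * 1/suc k ≤ ε
  bound k h = begin
    p * 1/suc k                   ≤⟨ *-monoˡ (1/suc k) (0≤1/suc k) p≤ ⟩
    ε * fromℕ (suc k) * 1/suc k   ≡⟨ *-assoc ε (fromℕ (suc k)) (1/suc k) ⟩
    ε * (fromℕ (suc k) * 1/suc k) ≡⟨ cong (ε *_) (suc*1/suc k) ⟩
    ε * 1ℚ                        ≡⟨ *-identityʳ ε ⟩
    ε                             ∎
    where
    p≤ : p ≤ ε * fromℕ (suc k)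
    p≤ = begin
      p                 ≡⟨ *-identityˡ p ⟨
      1ℚ * p            ≡⟨ cong (_* p) (*-inverseʳ ε) ⟨
      ε * 1/ ε * p      ≡⟨ trans (*-assoc ε (1/ ε) p) (cong (ε *_) (*-comm (1/ ε) p)) ⟩
      ε * (p * 1/ ε)    ≤⟨ *-monoʳ ε (<⇒≤ 0<ε) h ⟩
      ε * fromℕ k       ≤⟨ *-monoʳ ε (<⇒≤ 0<ε) (fromℕ-mono (ℕ.n≤1+n k)) ⟩
      ε * fromℕ (suc k) ∎

shrink : ∀ p {ε} → 0ℚ < ε → ∃[ δ ] 0ℚ < δ × p * δ ≤ ε
shrink p 0<ε = 1/suc k , 0<1/suc k , proj₂ (1/suc-small p 0<ε)
  where
    k : ℕ
    k = proj₁ (1/suc-small p 0<ε)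

------------------------------------------------------------------------
-- Real numbers as Cauchy sequences of rationals

IsCauchy : (ℕ → ℚ) → Set
IsCauchy x = ∀ {ε} → 0ℚ < ε →
  ∃[ N ] (∀ {m n} → N ℕ.≤ m → N ℕ.≤ n → ∣ x m - x n ∣ ≤ ε)

record ℝ : Set where
  constructor mkℝ
  field
    seq      : ℕ → ℚ
    isCauchy : IsCauchy seq

open ℝ public

infix  4 _≤ᴿ_ _<ᴿ_ _≃ᴿ_
infixl 6 _+ᴿ_
infixl 7 _*ᴿ_

_≤ᴿ_ : ℝ → ℝ → Set
x ≤ᴿ y = ∀ {ε} → 0ℚ < ε → ∃[ N ] (∀ {n} → N ℕ.≤ n → seq x n ≤ seq y n + ε)

_<ᴿ_ : ℝ → ℝ → Set
x <ᴿ y = ∃[ ε ] 0ℚ < ε × ∃[ N ] (∀ {n} → N ℕ.≤ n → seq x n + ε ≤ seq y n)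

_≃ᴿ_ : ℝ → ℝ → Set
x ≃ᴿ y = x ≤ᴿ y × y ≤ᴿ x

fromℚ : ℚ → ℝ
fromℚ q = mkℝ (λ _ → q) λ 0<ε → 0 , λ _ _ → ≤-trans (≤-reflexive
  (cong ∣_∣ (+-inverseʳ q))) (<⇒≤ 0<ε)

0ᴿ 1ᴿ : ℝ
0ᴿ = fromℚ 0ℚ
1ᴿ = fromℚ 1ℚ

ℕ→ℝ : ℕ → ℝ
ℕ→ℝ n = fromℚ (fromℕ n)

bounded : (x : ℝ) → ∃[ B ] 0ℚ ≤ B × ∃[ N ] (∀ {n} → N ℕ.≤ n → ∣ seq x n ∣ ≤ B)
bounded (mkℝ x cx) with cx (positive⁻¹ 1ℚ)
... | N , h = ∣ x N ∣ + 1ℚ , 0≤+ (0≤∣p∣ (x N)) (<⇒≤ (positive⁻¹ 1ℚ)) , N , λ {n} N≤n →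
  subst (λ t → ∣ t ∣ ≤ ∣ x N ∣ + 1ℚ)
    (solve 2 (λ a b → a :+ (b :- a) := b) refl (x N) (x n))
    (≤-trans (∣p+q∣≤∣p∣+∣q∣ (x N) (x n - x N)) (+-monoʳ-≤ ∣ x N ∣ (h N≤n ℕ.≤-refl)))

_+ᴿ_ : ℝ → ℝ → ℝ
seq (x +ᴿ y) n = seq x n + seq y n
isCauchy (x +ᴿ y) {ε} 0<ε with isCauchy x (0<½ 0<ε) | isCauchy y (0<½ 0<ε)
... | M , hx | N , hy = M ℕ.⊔ N , λ {m} {n} m≥ n≥ →
  subst (λ t → ∣ t ∣ ≤ ε)
    (solve 4 (λ a b c d → a :- c :+ (b :- d) := a :+ b :- (c :+ d)) refl
      (seq x m) (seq y m) (seq x n) (seq y n))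
    (≤-trans (∣p+q∣≤∣p∣+∣q∣ (seq x m - seq x n) (seq y m - seq y n))
      (subst (∣ seq x m - seq x n ∣ + ∣ seq y m - seq y n ∣ ≤_) (½+½ ε)
        (+-mono-≤ (hx (ℕ.m⊔n≤o⇒m≤o M N m≥) (ℕ.m⊔n≤o⇒m≤o M N n≥))
                  (hy (ℕ.m⊔n≤o⇒n≤o M N m≥) (ℕ.m⊔n≤o⇒n≤o M N n≥)))))

*-close : ∀ {a b c d A B δ} → 0ℚ ≤ A → 0ℚ ≤ B → ∣ a ∣ ≤ A → ∣ d ∣ ≤ B →
          ∣ a - c ∣ ≤ δ → ∣ b - d ∣ ≤ δ → ∣ a * b - c * d ∣ ≤ (A + B) * δ
*-close {a} {b} {c} {d} {A} {B} {δ} 0≤A 0≤B hA hB hac hbd = begin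
  ∣ a * b - c * d ∣
    ≡⟨ cong ∣_∣ (solve 4 (λ a b c d →
         a :* b :- c :* d := a :* (b :- d) :+ d :* (a :- c)) refl a b c d) ⟩
  ∣ a * (b - d) + d * (a - c) ∣
    ≤⟨ ∣p+q∣≤∣p∣+∣q∣ (a * (b - d)) (d * (a - c)) ⟩
  ∣ a * (b - d) ∣ + ∣ d * (a - c) ∣
    ≡⟨ cong₂ _+_ (∣p*q∣≡∣p∣*∣q∣ a (b - d)) (∣p*q∣≡∣p∣*∣q∣ d (a - c)) ⟩
  ∣ a ∣ * ∣ b - d ∣ + ∣ d ∣ * ∣ a - c ∣
    ≤⟨ +-mono-≤ (*-mono 0≤A (0≤∣p∣ (b - d)) hA hbd)
                (*-mono 0≤B (0≤∣p∣ (a - c)) hB hac) ⟩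
  A * δ + B * δ
    ≡⟨ *-distribʳ-+ δ A B ⟨
  (A + B) * δ ∎
  where open ≤-Reasoning

*-isCauchy : ∀ x y → IsCauchy (λ n → seq x n * seq y n)
*-isCauchy x y {ε} 0<ε = K , λ m≥ n≥ → ≤-trans
  (*-close 0≤A 0≤B (hA (M₁≤ m≥)) (hB (N₁≤ n≥))
    (hx (M₂≤ m≥) (M₂≤ n≥)) (hy (N₂≤ m≥) (N₂≤ n≥))) hδ
  where
  A B δ : ℚ
  A = proj₁ (bounded x)
  B = proj₁ (bounded y)
  δ = proj₁ (shrink (A + B) 0<ε)
  0≤A = proj₁ (proj₂ (bounded x))
  0≤B = proj₁ (proj₂ (bounded y))
  0<δ = proj₁ (proj₂ (shrink (A + B) 0<ε))
  hδ = proj₂ (proj₂ (shrink (A + B) 0<ε))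
  M₁ N₁ M₂ N₂ K : ℕ
  M₁ = proj₁ (proj₂ (proj₂ (bounded x)))
  N₁ = proj₁ (proj₂ (proj₂ (bounded y)))
  M₂ = proj₁ (isCauchy x 0<δ)
  N₂ = proj₁ (isCauchy y 0<δ)
  K = (M₁ ℕ.⊔ N₁) ℕ.⊔ (M₂ ℕ.⊔ N₂)
  hA = proj₂ (proj₂ (proj₂ (bounded x)))
  hB = proj₂ (proj₂ (proj₂ (bounded y)))
  hx = proj₂ (isCauchy x 0<δ)
  hy = proj₂ (isCauchy y 0<δ)
  M₁≤ : ∀ {m} → K ℕ.≤ m → M₁ ℕ.≤ m
  M₁≤ h = ℕ.m⊔n≤o⇒m≤o M₁ N₁ (ℕ.m⊔n≤o⇒m≤o (M₁ ℕ.⊔ N₁) (M₂ ℕ.⊔ N₂) h)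
  N₁≤ : ∀ {m} → K ℕ.≤ m → N₁ ℕ.≤ m
  N₁≤ h = ℕ.m⊔n≤o⇒n≤o M₁ N₁ (ℕ.m⊔n≤o⇒m≤o (M₁ ℕ.⊔ N₁) (M₂ ℕ.⊔ N₂) h)
  M₂≤ : ∀ {m} → K ℕ.≤ m → M₂ ℕ.≤ m
  M₂≤ h = ℕ.m⊔n≤o⇒m≤o M₂ N₂ (ℕ.m⊔n≤o⇒n≤o (M₁ ℕ.⊔ N₁) (M₂ ℕ.⊔ N₂) h)
  N₂≤ : ∀ {m} → K ℕ.≤ m → N₂ ℕ.≤ m
  N₂≤ h = ℕ.m⊔n≤o⇒n≤o M₂ N₂ (ℕ.m⊔n≤o⇒n≤o (M₁ ℕ.⊔ N₁) (M₂ ℕ.⊔ N₂) h)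

_*ᴿ_ : ℝ → ℝ → ℝ
x *ᴿ y = mkℝ (λ n → seq x n * seq y n) (*-isCauchy x y)

------------------------------------------------------------------------
-- The exponential function

-- aᵏ / k!
expTerm : ℕ → ℚ → ℚ
expTerm zero    a = 1ℚ
expTerm (suc k) a = expTerm k a * (a * 1/suc k)

-- Σ_{k < m} aᵏ / k!
expSum : ℕ → ℚ → ℚ
expSum zero    a = 0ℚ
expSum (suc m) a = expSum m a + expTerm m a

0≤expTerm : ∀ k {a} → 0ℚ ≤ a → 0ℚ ≤ expTerm k a
0≤expTerm zero    0≤a = <⇒≤ (positive⁻¹ 1ℚ)
0≤expTerm (suc k) 0≤a = 0≤* (0≤expTerm k 0≤a) (0≤* 0≤a (0≤1/suc k))

expTerm-mono : ∀ k {a b} → 0ℚ ≤ a → a ≤ b → expTerm k a ≤ expTerm k b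
expTerm-mono zero    0≤a a≤b = ≤-refl
expTerm-mono (suc k) 0≤a a≤b =
  *-mono (0≤expTerm k (≤-trans 0≤a a≤b)) (0≤* 0≤a (0≤1/suc k))
    (expTerm-mono k 0≤a a≤b) (*-monoˡ (1/suc k) (0≤1/suc k) a≤b)

∣expTerm∣≤ : ∀ k {a B} → ∣ a ∣ ≤ B → ∣ expTerm k a ∣ ≤ expTerm k B
∣expTerm∣≤ zero            h = ≤-refl
∣expTerm∣≤ (suc k) {a} {B} h = begin
  ∣ expTerm k a * (a * 1/suc k) ∣
    ≡⟨ trans (∣p*q∣≡∣p∣*∣q∣ (expTerm k a) _)
         (cong (∣ expTerm k a ∣ *_) (trans (∣p*q∣≡∣p∣*∣q∣ a (1/suc k))
           (cong (∣ a ∣ *_) (0≤p⇒∣p∣≡p (0≤1/suc k))))) ⟩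
  ∣ expTerm k a ∣ * (∣ a ∣ * 1/suc k)
    ≤⟨ *-mono (0≤expTerm k (≤-trans (0≤∣p∣ a) h)) (0≤* (0≤∣p∣ a) (0≤1/suc k))
         (∣expTerm∣≤ k h) (*-monoˡ (1/suc k) (0≤1/suc k) h) ⟩
  expTerm k B * (B * 1/suc k) ∎
  where open ≤-Reasoning

-- Once 2B ≤ k the terms at least halve, so expSum + 2 expTerm decreases.

module Tail {B} (0≤B : 0ℚ ≤ B) where

  open ≤-Reasoning

  M : ℕ
  M = 2 ℕ.* proj₁ (archimedean B)

  T S : ℕ → ℚ
  T k = expTerm k B
  S k = expSum k B

  0≤T : ∀ k → 0ℚ ≤ T k
  0≤T k = 0≤expTerm k 0≤B

  2B≤M : B + B ≤ fromℕ M
  2B≤M = subst (B + B ≤_) (dbl b) (+-mono-≤ B≤b B≤b)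
    where
    b = proj₁ (archimedean B)
    B≤b = proj₂ (archimedean B)
    dbl : ∀ n → fromℕ n + fromℕ n ≡ fromℕ (2 ℕ.* n)
    dbl n = trans (fromℕ-+ n n) (cong (λ t → fromℕ (n ℕ.+ t)) (sym (ℕ.+-identityʳ n)))

  halve : ∀ {k} → M ℕ.≤ k → T (suc k) + T (suc k) ≤ T k
  halve {k} M≤k = begin
    T k * (B * 1/suc k) + T k * (B * 1/suc k)
      ≡⟨ solve 3 (λ t b r → t :* (b :* r) :+ t :* (b :* r) := t :* ((b :+ b) :* r))
           refl (T k) B (1/suc k) ⟩
    T k * ((B + B) * 1/suc k)
      ≤⟨ *-monoʳ (T k) (0≤T k) (*-monoˡ (1/suc k) (0≤1/suc k)
           (≤-trans 2B≤M (fromℕ-mono (ℕ.m≤n⇒m≤1+n M≤k)))) ⟩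
    T k * (fromℕ (suc k) * 1/suc k)
      ≡⟨ trans (cong (T k *_) (suc*1/suc k)) (*-identityʳ (T k)) ⟩
    T k ∎

  T-decreasing : ∀ q {m} → M ℕ.≤ m → T (q ℕ.+ m) ≤ T m
  T-decreasing zero        M≤m = ≤-refl
  T-decreasing (suc q) {m} M≤m = begin
    T (suc q ℕ.+ m)                     ≡⟨ +-identityˡ _ ⟨
    0ℚ + T (suc q ℕ.+ m)                ≤⟨ +-monoˡ-≤ _ (0≤T (suc q ℕ.+ m)) ⟩
    T (suc q ℕ.+ m) + T (suc q ℕ.+ m)   ≤⟨ halve (ℕ.m≤n⇒m≤o+n q M≤m) ⟩
    T (q ℕ.+ m)                         ≤⟨ T-decreasing q M≤m ⟩
    T m                                 ∎

  U : ℕ → ℚ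
  U k = S k + (T k + T k)

  U-decreasing : ∀ q {m} → M ℕ.≤ m → U (q ℕ.+ m) ≤ U m
  U-decreasing zero        M≤m = ≤-refl
  U-decreasing (suc q) {m} M≤m = ≤-trans
    (≤-trans (+-monoʳ-≤ (S (suc q ℕ.+ m)) (halve (ℕ.m≤n⇒m≤o+n q M≤m)))
      (≤-reflexive (+-assoc (S (q ℕ.+ m)) (T (q ℕ.+ m)) (T (q ℕ.+ m)))))
    (U-decreasing q M≤m)

  0≤S : ∀ k → 0ℚ ≤ S k
  0≤S zero    = ≤-refl
  0≤S (suc k) = 0≤+ (0≤S k) (0≤T k)

  S≤U : ∀ k → S k ≤ U k
  S≤U k = subst (_≤ U k) (+-identityʳ (S k)) (+-monoʳ-≤ (S k) (0≤+ (0≤T k) (0≤T k)))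

  S≤ : ∀ {m} → M ℕ.≤ m → S m ≤ U M
  S≤ {m} M≤m = subst (λ t → S t ≤ U M) (ℕ.m∸n+n≡m M≤m)
    (≤-trans (S≤U (m ℕ.∸ M ℕ.+ M)) (U-decreasing (m ℕ.∸ M) ℕ.≤-refl))

  dominated : ∀ q m {a} → ∣ a ∣ ≤ B →
              ∣ expSum (q ℕ.+ m) a - expSum m a ∣ ≤ S (q ℕ.+ m) - S m
  dominated zero    m {a} h = ≤-reflexive
    (trans (cong ∣_∣ (+-inverseʳ (expSum m a))) (sym (+-inverseʳ (S m))))
  dominated (suc q) m {a} h = begin
    ∣ e + t - f ∣      ≡⟨ cong ∣_∣ (comm3 e t f) ⟩
    ∣ e - f + t ∣      ≤⟨ ∣p+q∣≤∣p∣+∣q∣ (e - f) t ⟩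
    ∣ e - f ∣ + ∣ t ∣  ≤⟨ +-mono-≤ (dominated q m h) (∣expTerm∣≤ (q ℕ.+ m) h) ⟩
    S (q ℕ.+ m) - S m + T (q ℕ.+ m)
                       ≡⟨ comm3 (S (q ℕ.+ m)) (T (q ℕ.+ m)) (S m) ⟨
    S (q ℕ.+ m) + T (q ℕ.+ m) - S m ∎
    where
    e = expSum (q ℕ.+ m) a
    t = expTerm (q ℕ.+ m) a
    f = expSum m a
    comm3 : ∀ e t f → e + t - f ≡ e - f + t
    comm3 = solve 3 (λ e t f → e :+ t :- f := e :- f :+ t) refl

  tail : ∀ {m n a} → ∣ a ∣ ≤ B → M ℕ.≤ m → m ℕ.≤ n →
         ∣ expSum n a - expSum m a ∣ ≤ T m + T m
  tail {m} {n} {a} h M≤m m≤n =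
    subst (λ k → ∣ expSum k a - expSum m a ∣ ≤ T m + T m) (ℕ.m∸n+n≡m m≤n)
      (≤-trans (dominated q m h) (0≤-⇒≤ (subst (0ℚ ≤_)
        (solve 3 (λ s d r → s :+ d :- r := d :- (r :- s)) refl (S m) (T m + T m) (S (q ℕ.+ m)))
        (≤⇒0≤- (≤-trans (S≤U (q ℕ.+ m)) (U-decreasing q M≤m))))))
    where q = n ℕ.∸ m

  T-small : ∀ {ε} → 0ℚ < ε →
            ∃[ N ] M ℕ.≤ N × (∀ {m} → N ℕ.≤ m → T m + T m ≤ ε)
  T-small {ε} 0<ε = suc (k ℕ.⊔ M) , ℕ.m≤n⇒m≤1+n (ℕ.m≤n⊔m k M) , bound
    where
    k : ℕ
    k = proj₁ (1/suc-small ((T M + T M) * B) 0<ε)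
    bound : ∀ {m} → suc (k ℕ.⊔ M) ℕ.≤ m → T m + T m ≤ ε
    bound {suc m} (ℕ.s≤s m≥) = begin
      T m * (B * 1/suc m) + T m * (B * 1/suc m)
        ≡⟨ solve 3 (λ t b r → t :* (b :* r) :+ t :* (b :* r) := (t :+ t) :* b :* r)
             refl (T m) B (1/suc m) ⟩
      (T m + T m) * B * 1/suc m
        ≤⟨ *-mono (0≤* (0≤+ (0≤T M) (0≤T M)) 0≤B) (0≤1/suc m)
             (*-monoˡ B 0≤B (+-mono-≤ Tm≤ Tm≤))
             (1/suc-anti (ℕ.m⊔n≤o⇒m≤o k M m≥)) ⟩
      (T M + T M) * B * 1/suc k
        ≤⟨ proj₂ (1/suc-small ((T M + T M) * B) 0<ε) ⟩
      ε ∎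
      where
      Tm≤ : T m ≤ T M
      Tm≤ = subst (λ t → T t ≤ T M) (ℕ.m∸n+n≡m (ℕ.m⊔n≤o⇒n≤o k M m≥))
              (T-decreasing (m ℕ.∸ M) ℕ.≤-refl)

  expSum-uniform : ∀ {ε} → 0ℚ < ε → ∃[ N ] M ℕ.≤ N ×
    (∀ {m n a} → ∣ a ∣ ≤ B → N ℕ.≤ m → N ℕ.≤ n → ∣ expSum m a - expSum n a ∣ ≤ ε)
  expSum-uniform {ε} 0<ε = N , M≤N , go
    where
    N : ℕ
    N = proj₁ (T-small 0<ε)
    M≤N : M ℕ.≤ N
    M≤N = proj₁ (proj₂ (T-small 0<ε))
    hN : ∀ {m} → N ℕ.≤ m → T m + T m ≤ ε
    hN = proj₂ (proj₂ (T-small 0<ε))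
    go : ∀ {m n a} → ∣ a ∣ ≤ B → N ℕ.≤ m → N ℕ.≤ n → ∣ expSum m a - expSum n a ∣ ≤ ε
    go {m} {n} {a} h m≥ n≥ with ℕ.≤-total m n
    ... | inj₁ m≤n = subst (_≤ ε) (∣-∣-comm (expSum n a) (expSum m a))
                       (≤-trans (tail h (ℕ.≤-trans M≤N m≥) m≤n) (hN m≥))
    ... | inj₂ n≤m = ≤-trans (tail h (ℕ.≤-trans M≤N n≥) n≤m) (hN n≥)

  expTerm-lipschitz : ∀ k {a b} → ∣ a ∣ ≤ B → ∣ b ∣ ≤ B →
    ∣ expTerm (suc k) a - expTerm (suc k) b ∣ ≤ T k * ∣ a - b ∣
  expTerm-lipschitz zero {a} {b} ha hb = ≤-reflexive (trans
    (cong ∣_∣ (solve 2 (λ a b → con 1ℚ :* (a :* con 1ℚ) :- con 1ℚ :* (b :* con 1ℚ) := a :- b)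
      refl a b))
    (sym (*-identityˡ ∣ a - b ∣)))
  expTerm-lipschitz (suc k) {a} {b} ha hb = begin
    ∣ ta * (a * r) - tb * (b * r) ∣
      ≡⟨ cong ∣_∣ (solve 5 (λ ta tb a b r → ta :* (a :* r) :- tb :* (b :* r)
           := r :* (a :* (ta :- tb) :+ tb :* (a :- b))) refl ta tb a b r) ⟩
    ∣ r * (a * (ta - tb) + tb * (a - b)) ∣
      ≡⟨ trans (∣p*q∣≡∣p∣*∣q∣ r w) (cong (_* ∣ w ∣) (0≤p⇒∣p∣≡p (0≤1/suc (suc k)))) ⟩
    r * ∣ a * (ta - tb) + tb * (a - b) ∣
      ≤⟨ *-monoʳ r (0≤1/suc (suc k)) (≤-trans (∣p+q∣≤∣p∣+∣q∣ (a * (ta - tb)) (tb * (a - b)))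
           (≤-reflexive (cong₂ _+_ (∣p*q∣≡∣p∣*∣q∣ a (ta - tb)) (∣p*q∣≡∣p∣*∣q∣ tb (a - b))))) ⟩
    r * (∣ a ∣ * ∣ ta - tb ∣ + ∣ tb ∣ * d)
      ≤⟨ *-monoʳ r (0≤1/suc (suc k)) (+-mono-≤
           (*-mono 0≤B (0≤∣p∣ (ta - tb)) ha (expTerm-lipschitz k ha hb))
           (*-monoˡ d (0≤∣p∣ (a - b)) (∣expTerm∣≤ (suc k) hb))) ⟩
    r * (B * (T k * d) + T (suc k) * d)
      ≡⟨ cong (λ t → r * (t + T (suc k) * d)) BT ⟩
    r * (fromℕ (suc k) * (T (suc k) * d) + T (suc k) * d)
      ≡⟨ solve 3 (λ r n t → r :* (n :* t :+ t) := (n :+ con 1ℚ) :* r :* t)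
           refl r (fromℕ (suc k)) (T (suc k) * d) ⟩
    (fromℕ (suc k) + 1ℚ) * r * (T (suc k) * d)
      ≡⟨ cong (λ t → t * r * (T (suc k) * d)) (sym (fromℕ-suc (suc k))) ⟩
    fromℕ (suc (suc k)) * r * (T (suc k) * d)
      ≡⟨ trans (cong (_* (T (suc k) * d)) (suc*1/suc (suc k))) (*-identityˡ _) ⟩
    T (suc k) * d ∎
    where
    ta = expTerm (suc k) a
    tb = expTerm (suc k) b
    r = 1/suc (suc k)
    d = ∣ a - b ∣
    w = a * (ta - tb) + tb * (a - b)
    BT : B * (T k * d) ≡ fromℕ (suc k) * (T k * (B * 1/suc k) * d)
    BT = sym (trans
      (solve 5 (λ n t b r d → n :* (t :* (b :* r) :* d) := n :* r :* (b :* (t :* d)))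
        refl (fromℕ (suc k)) (T k) B (1/suc k) d)
      (trans (cong (_* (B * (T k * d))) (suc*1/suc k)) (*-identityˡ _)))

  expSum-lipschitz : ∀ m {a b} → ∣ a ∣ ≤ B → ∣ b ∣ ≤ B →
    ∣ expSum (suc m) a - expSum (suc m) b ∣ ≤ S m * ∣ a - b ∣
  expSum-lipschitz zero    {a} {b} ha hb = ≤-reflexive (sym (*-zeroˡ ∣ a - b ∣))
  expSum-lipschitz (suc m) {a} {b} ha hb = begin
    ∣ sa + ta - (sb + tb) ∣
      ≡⟨ cong ∣_∣ (solve 4 (λ a b c d → a :+ b :- (c :+ d) := a :- c :+ (b :- d))
           refl sa ta sb tb) ⟩
    ∣ sa - sb + (ta - tb) ∣
      ≤⟨ ∣p+q∣≤∣p∣+∣q∣ (sa - sb) (ta - tb) ⟩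
    ∣ sa - sb ∣ + ∣ ta - tb ∣
      ≤⟨ +-mono-≤ (expSum-lipschitz m ha hb) (expTerm-lipschitz m ha hb) ⟩
    S m * ∣ a - b ∣ + T m * ∣ a - b ∣
      ≡⟨ *-distribʳ-+ ∣ a - b ∣ (S m) (T m) ⟨
    (S m + T m) * ∣ a - b ∣ ∎
    where
    sa = expSum (suc m) a
    sb = expSum (suc m) b
    ta = expTerm (suc m) a
    tb = expTerm (suc m) b

  expSum-close : ∀ {ε} → 0ℚ < ε → ∃[ N ] ∃[ δ ] 0ℚ < δ ×
    (∀ {m n a b} → N ℕ.≤ m → N ℕ.≤ n → ∣ a ∣ ≤ B → ∣ b ∣ ≤ B → ∣ a - b ∣ ≤ δ →
      ∣ expSum m a - expSum n b ∣ ≤ ε)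
  expSum-close {ε} 0<ε = suc N , δ , 0<δ , close
    where
    N : ℕ
    N = proj₁ (expSum-uniform (0<½ 0<ε))
    M≤N : M ℕ.≤ N
    M≤N = proj₁ (proj₂ (expSum-uniform (0<½ 0<ε)))
    E δ : ℚ
    E = U M
    δ = proj₁ (shrink E (0<½ 0<ε))
    0<δ : 0ℚ < δ
    0<δ = proj₁ (proj₂ (shrink E (0<½ 0<ε)))
    0≤E : 0ℚ ≤ E
    0≤E = ≤-trans (0≤S M) (S≤U M)
    close : ∀ {m n a b} → suc N ℕ.≤ m → suc N ℕ.≤ n → ∣ a ∣ ≤ B → ∣ b ∣ ≤ B →
            ∣ a - b ∣ ≤ δ → ∣ expSum m a - expSum n b ∣ ≤ ε
    close {m} {suc n} {a} {b} m≥ (ℕ.s≤s n≥) ha hb hab = begin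
      ∣ expSum m a - expSum (suc n) b ∣
        ≤⟨ ∣-∣-triangle (expSum m a) (expSum (suc n) a) (expSum (suc n) b) ⟩
      ∣ expSum m a - expSum (suc n) a ∣ + ∣ expSum (suc n) a - expSum (suc n) b ∣
        ≤⟨ +-mono-≤ (proj₂ (proj₂ (expSum-uniform (0<½ 0<ε))) ha
             (ℕ.≤-trans (ℕ.n≤1+n N) m≥) (ℕ.m≤n⇒m≤1+n n≥)) (expSum-lipschitz n ha hb) ⟩
      ε * ½ + S n * ∣ a - b ∣
        ≤⟨ +-monoʳ-≤ (ε * ½) (*-mono 0≤E (0≤∣p∣ (a - b)) (S≤ (ℕ.≤-trans M≤N n≥)) hab) ⟩
      ε * ½ + E * δ
        ≤⟨ +-monoʳ-≤ (ε * ½) (proj₂ (proj₂ (shrink E (0<½ 0<ε)))) ⟩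
      ε * ½ + ε * ½
        ≡⟨ ½+½ ε ⟩
      ε ∎

exp-isCauchy : ∀ x → IsCauchy (λ m → expSum m (seq x m))
exp-isCauchy x {ε} 0<ε = K , λ m≥ n≥ →
  close (N₂≤ m≥) (N₂≤ n≥) (hB (N₁≤ m≥)) (hB (N₁≤ n≥))
    (proj₂ (isCauchy x 0<δ) (N₃≤ m≥) (N₃≤ n≥))
  where
  B δ : ℚ
  B = proj₁ (bounded x)
  0≤B : 0ℚ ≤ B
  0≤B = proj₁ (proj₂ (bounded x))
  δ = proj₁ (proj₂ (Tail.expSum-close 0≤B 0<ε))
  0<δ : 0ℚ < δ
  0<δ = proj₁ (proj₂ (proj₂ (Tail.expSum-close 0≤B 0<ε)))
  N₁ N₂ N₃ K : ℕ
  N₁ = proj₁ (proj₂ (proj₂ (bounded x)))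
  N₂ = proj₁ (Tail.expSum-close 0≤B 0<ε)
  N₃ = proj₁ (isCauchy x 0<δ)
  K = N₁ ℕ.⊔ (N₂ ℕ.⊔ N₃)
  hB : ∀ {m} → N₁ ℕ.≤ m → ∣ seq x m ∣ ≤ B
  hB = proj₂ (proj₂ (proj₂ (bounded x)))
  close : ∀ {m n a b} → N₂ ℕ.≤ m → N₂ ℕ.≤ n → ∣ a ∣ ≤ B → ∣ b ∣ ≤ B →
          ∣ a - b ∣ ≤ δ → ∣ expSum m a - expSum n b ∣ ≤ ε
  close = proj₂ (proj₂ (proj₂ (Tail.expSum-close 0≤B 0<ε)))
  N₁≤ : ∀ {m} → K ℕ.≤ m → N₁ ℕ.≤ m
  N₁≤ = ℕ.m⊔n≤o⇒m≤o N₁ (N₂ ℕ.⊔ N₃)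
  N₂≤ : ∀ {m} → K ℕ.≤ m → N₂ ℕ.≤ m
  N₂≤ h = ℕ.m⊔n≤o⇒m≤o N₂ N₃ (ℕ.m⊔n≤o⇒n≤o N₁ (N₂ ℕ.⊔ N₃) h)
  N₃≤ : ∀ {m} → K ℕ.≤ m → N₃ ℕ.≤ m
  N₃≤ h = ℕ.m⊔n≤o⇒n≤o N₂ N₃ (ℕ.m⊔n≤o⇒n≤o N₁ (N₂ ℕ.⊔ N₃) h)

exp : ℝ → ℝ
exp x = mkℝ (λ m → expSum m (seq x m)) (exp-isCauchy x)

------------------------------------------------------------------------
-- Inverses of increasing functions

-- The last of p 1, …, p J at which f is at most q; 0 if there is none.
search : (ℚ → ℚ) → (ℕ → ℚ) → ℚ → ℕ → ℚ
search f p q zero    = 0ℚ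
search f p q (suc J) with f (p (suc J)) ≤? q
... | yes _ = p (suc J)
... | no  _ = search f p q J

inverseApprox : (ℕ → ℚ → ℚ) → ℕ → ℚ → ℚ
inverseApprox f m q = search (f m) (λ j → fromℕ j * 1/suc m) q (suc m ℕ.* suc m)

-- f m approximates, for large m, a function on [0, ∞) that is unbounded
-- and increases at a definite rate.
record Invertible (f : ℕ → ℚ → ℚ) : Set where
  field
    uniform   : ∀ B {ε} → 0ℚ < ε → ∃[ N ]
      (∀ {m n a} → N ℕ.≤ m → N ℕ.≤ n → 0ℚ ≤ a → a ≤ B → f m a ≤ f n a + ε)
    expansive : ∀ {ε} → 0ℚ < ε → ∃[ δ ] 0ℚ < δ × ∃[ N ]
      (∀ {m a b} → N ℕ.≤ m → 0ℚ ≤ a → a + ε ≤ b → f m a + δ ≤ f m b)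
    unbounded : ∀ B → ∃[ Y ] 0ℚ < Y × ∃[ N ]
      (∀ {m y} → N ℕ.≤ m → Y ≤ y → B < f m y)

search-spec : ∀ f p {h} q J → (∀ j → 0ℚ ≤ p j) → p 0 ≡ 0ℚ → (∀ j → p (suc j) ≡ p j + h) →
  0ℚ ≤ search f p q J ×
  (0ℚ < search f p q J → f (search f p q J) ≤ q) ×
  (search f p q J ≡ p J ⊎ q < f (search f p q J + h))
search-spec f p q zero    0≤p p0 p+ =
  ≤-refl , (λ 0<0 → contradiction 0<0 (<-irrefl refl)) , inj₁ (sym p0)
search-spec f p q (suc J) 0≤p p0 p+ with f (p (suc J)) ≤? q
... | yes h = 0≤p (suc J) , (λ _ → h) , inj₁ refl
... | no ≰q with search-spec f p q J 0≤p p0 p+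
...   | 0≤s , lower , inj₂ upper = 0≤s , lower , inj₂ upper
...   | 0≤s , lower , inj₁ s≡p   = 0≤s , lower , inj₂
        (subst (λ t → q < f t) (trans (p+ J) (cong (_+ _) (sym s≡p))) (≰⇒> ≰q))

record Approx (f : ℕ → ℚ → ℚ) (m : ℕ) (q r : ℚ) : Set where
  field
    nonneg : 0ℚ ≤ r
    lower  : 0ℚ < r → f m r ≤ q
    upper  : r ≡ fromℕ (suc m) ⊎ q < f m (r + 1/suc m)

grid-top : ∀ m → fromℕ (suc m ℕ.* suc m) * 1/suc m ≡ fromℕ (suc m)
grid-top m = begin
  fromℕ (suc m ℕ.* suc m) * 1/suc m          ≡⟨ cong (_* 1/suc m) (fromℕ-* (suc m) (suc m)) ⟨
  fromℕ (suc m) * fromℕ (suc m) * 1/suc m    ≡⟨ *-assoc (fromℕ (suc m)) (fromℕ (suc m)) (1/suc m) ⟩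
  fromℕ (suc m) * (fromℕ (suc m) * 1/suc m)  ≡⟨ cong (fromℕ (suc m) *_) (suc*1/suc m) ⟩
  fromℕ (suc m) * 1ℚ                         ≡⟨ *-identityʳ (fromℕ (suc m)) ⟩
  fromℕ (suc m)                              ∎
  where open ≡-Reasoning

grid-suc : ∀ m j → fromℕ (suc j) * 1/suc m ≡ fromℕ j * 1/suc m + 1/suc m
grid-suc m j = begin
  fromℕ (suc j) * 1/suc m               ≡⟨ cong (_* 1/suc m) (fromℕ-suc j) ⟩
  (fromℕ j + 1ℚ) * 1/suc m              ≡⟨ *-distribʳ-+ (1/suc m) (fromℕ j) 1ℚ ⟩
  fromℕ j * 1/suc m + 1ℚ * 1/suc m      ≡⟨ cong (λ t → fromℕ j * 1/suc m + t) (*-identityˡ (1/suc m)) ⟩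
  fromℕ j * 1/suc m + 1/suc m           ∎
  where open ≡-Reasoning

search-approx : ∀ f m q p J → (∀ j → 0ℚ ≤ p j) → p 0 ≡ 0ℚ →
  (∀ j → p (suc j) ≡ p j + 1/suc m) → p J ≡ fromℕ (suc m) →
  Approx f m q (search (f m) p q J)
search-approx f m q p J 0≤p p0 p+ pJ = record
  { nonneg = proj₁ spec
  ; lower  = proj₁ (proj₂ spec)
  ; upper  = Sum.map₁ (λ e → trans e pJ) (proj₂ (proj₂ spec))
  }
  where spec = search-spec (f m) p q J 0≤p p0 p+

inverse-approx : ∀ f m q → Approx f m q (inverseApprox f m q)
inverse-approx f m q = search-approx f m q (λ j → fromℕ j * 1/suc m) (suc m ℕ.* suc m)
  (λ j → 0≤* (0≤fromℕ j) (0≤1/suc m)) (*-zeroˡ (1/suc m)) (grid-suc m) (grid-top m)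

module Inverse {f : ℕ → ℚ → ℚ} (inv : Invertible f) where

  open Invertible inv

  module _ (B : ℚ) where

    Y : ℚ
    Y = proj₁ (unbounded B)

    0<Y : 0ℚ < Y
    0<Y = proj₁ (proj₂ (unbounded B))

    N₀ N₁ : ℕ
    N₀ = proj₁ (proj₂ (proj₂ (unbounded B)))
    N₁ = N₀ ℕ.⊔ proj₁ (archimedean Y)

    exceeds : ∀ {m y} → N₁ ℕ.≤ m → Y ≤ y → B < f m y
    exceeds m≥ = proj₂ (proj₂ (proj₂ (unbounded B)))
      (ℕ.m⊔n≤o⇒m≤o N₀ (proj₁ (archimedean Y)) m≥)

    Y≤ : ∀ {m} → N₁ ℕ.≤ m → Y ≤ fromℕ (suc m)
    Y≤ {m} m≥ = ≤-trans (proj₂ (archimedean Y)) (fromℕ-mono {proj₁ (archimedean Y)} {suc m}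
      (ℕ.m≤n⇒m≤1+n (ℕ.m⊔n≤o⇒n≤o N₀ (proj₁ (archimedean Y)) m≥)))

    below : ∀ {m q r} → N₁ ℕ.≤ m → q ≤ B → Approx f m q r → r < Y
    below {m} {q} {r} m≥ q≤B ap = ≰⇒> λ Y≤r → <-irrefl refl (<-≤-trans (exceeds m≥ Y≤r)
      (≤-trans (Approx.lower ap (<-≤-trans 0<Y Y≤r)) q≤B))

    above : ∀ {m q r} → N₁ ℕ.≤ m → q ≤ B → Approx f m q r → q < f m (r + 1/suc m)
    above {m} {q} {r} m≥ q≤B ap = Sum.[ absurd , id ]′ (Approx.upper ap)
      where
      absurd : r ≡ fromℕ (suc m) → q < f m (r + 1/suc m)
      absurd e = contradiction (below m≥ q≤B ap)
        (≤⇒≯ (subst (Y ≤_) (sym e) (Y≤ m≥)))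

  module _ (B : ℚ) {ε} (0<ε : 0ℚ < ε) where

    δ : ℚ
    δ = proj₁ (expansive (0<½ 0<ε))

    0<δ : 0ℚ < δ
    0<δ = proj₁ (proj₂ (expansive (0<½ 0<ε)))

    N₂ N₃ N₄ N : ℕ
    N₂ = proj₁ (proj₂ (proj₂ (expansive (0<½ 0<ε))))
    N₃ = proj₁ (uniform (Y B + 1ℚ) (0<½ 0<δ))
    N₄ = proj₁ (1/suc-small 1ℚ (0<½ 0<ε))
    N  = (N₁ B ℕ.⊔ N₂) ℕ.⊔ (N₃ ℕ.⊔ N₄)

    N₁≤ : ∀ {m} → N ℕ.≤ m → N₁ B ℕ.≤ m
    N₁≤ h = ℕ.m⊔n≤o⇒m≤o (N₁ B) N₂ (ℕ.m⊔n≤o⇒m≤o (N₁ B ℕ.⊔ N₂) (N₃ ℕ.⊔ N₄) h)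
    N₂≤ : ∀ {m} → N ℕ.≤ m → N₂ ℕ.≤ m
    N₂≤ h = ℕ.m⊔n≤o⇒n≤o (N₁ B) N₂ (ℕ.m⊔n≤o⇒m≤o (N₁ B ℕ.⊔ N₂) (N₃ ℕ.⊔ N₄) h)
    N₃≤ : ∀ {m} → N ℕ.≤ m → N₃ ℕ.≤ m
    N₃≤ h = ℕ.m⊔n≤o⇒m≤o N₃ N₄ (ℕ.m⊔n≤o⇒n≤o (N₁ B ℕ.⊔ N₂) (N₃ ℕ.⊔ N₄) h)
    N₄≤ : ∀ {m} → N ℕ.≤ m → N₄ ℕ.≤ m
    N₄≤ h = ℕ.m⊔n≤o⇒n≤o N₃ N₄ (ℕ.m⊔n≤o⇒n≤o (N₁ B ℕ.⊔ N₂) (N₃ ℕ.⊔ N₄) h)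

    close : ∀ {m n a b r s} → N ℕ.≤ m → N ℕ.≤ n → a ≤ B → b ≤ a + δ * ½ →
            Approx f m a r → Approx f n b s → s ≤ r + ε
    close {m} {n} {a} {b} {r} {s} m≥ n≥ a≤B b≤a ar as =
      ≮⇒≥ λ r+ε<s → <-irrefl refl (absurd (<⇒≤ r+ε<s))
      where
      open ≤-Reasoning
      t : ℚ
      t = r + 1/suc m
      0≤r : 0ℚ ≤ r
      0≤r = Approx.nonneg ar
      0<s : r + ε ≤ s → 0ℚ < s
      0<s h = <-≤-trans 0<ε (≤-trans (≤-reflexive (sym (+-identityˡ ε)))
              (≤-trans (+-monoˡ-≤ ε 0≤r) h))
      0≤t : 0ℚ ≤ t
      0≤t = 0≤+ 0≤r (0≤1/suc m)
      t≤ : t ≤ Y B + 1ℚ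
      t≤ = +-mono-≤ (<⇒≤ (below B (N₁≤ m≥) a≤B ar)) (1/suc-anti {0} {m} ℕ.z≤n)
      step : 1/suc m ≤ ε * ½
      step = ≤-trans (1/suc-anti (N₄≤ m≥)) (≤-trans
        (≤-reflexive (sym (*-identityˡ (1/suc N₄)))) (proj₂ (1/suc-small 1ℚ (0<½ 0<ε))))
      t+≤s : r + ε ≤ s → t + ε * ½ ≤ s
      t+≤s h = begin
        r + 1/suc m + ε * ½   ≡⟨ +-assoc r (1/suc m) (ε * ½) ⟩
        r + (1/suc m + ε * ½) ≤⟨ +-monoʳ-≤ r (+-monoˡ-≤ (ε * ½) step) ⟩
        r + (ε * ½ + ε * ½)   ≡⟨ cong (λ q → r + q) (½+½ ε) ⟩
        r + ε                 ≤⟨ h ⟩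
        s                     ∎
      absurd : r + ε ≤ s → f n t + δ < f n t + δ
      absurd h = begin-strict
        f n t + δ             ≤⟨ proj₂ (proj₂ (proj₂ (expansive (0<½ 0<ε)))) (N₂≤ n≥) 0≤t (t+≤s h) ⟩
        f n s                 ≤⟨ Approx.lower as (0<s h) ⟩
        b                     ≤⟨ b≤a ⟩
        a + δ * ½             <⟨ +-monoˡ-< (δ * ½) (above B (N₁≤ m≥) a≤B ar) ⟩
        f m t + δ * ½         ≤⟨ +-monoˡ-≤ (δ * ½)
                                   (proj₂ (uniform (Y B + 1ℚ) (0<½ 0<δ)) (N₃≤ m≥) (N₃≤ n≥) 0≤t t≤) ⟩
        f n t + δ * ½ + δ * ½ ≡⟨ +-assoc (f n t) (δ * ½) (δ * ½) ⟩
        f n t + (δ * ½ + δ * ½) ≡⟨ cong (λ q → f n t + q) (½+½ δ) ⟩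
        f n t + δ             ∎

  inverse-isCauchy : ∀ x → IsCauchy (λ m → inverseApprox f m (seq x m))
  inverse-isCauchy x {ε} 0<ε = K , λ {m} {n} m≥ n≥ →
    let am = inverse-approx f m (seq x m)
        an = inverse-approx f n (seq x n)
    in ∣-∣≤ (close B 0<ε (N≤ n≥) (N≤ m≥) (x≤B n≥) (near m≥ n≥) an am)
            (close B 0<ε (N≤ m≥) (N≤ n≥) (x≤B m≥) (near n≥ m≥) am an)
    where
    B : ℚ
    B = proj₁ (bounded x)
    L₁ L₂ K : ℕ
    L₁ = proj₁ (proj₂ (proj₂ (bounded x)))
    L₂ = proj₁ (isCauchy x (0<½ (0<δ B 0<ε)))
    K  = N B 0<ε ℕ.⊔ (L₁ ℕ.⊔ L₂)
    N≤ : ∀ {m} → K ℕ.≤ m → N B 0<ε ℕ.≤ m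
    N≤ = ℕ.m⊔n≤o⇒m≤o (N B 0<ε) (L₁ ℕ.⊔ L₂)
    L₁≤ : ∀ {m} → K ℕ.≤ m → L₁ ℕ.≤ m
    L₁≤ h = ℕ.m⊔n≤o⇒m≤o L₁ L₂ (ℕ.m⊔n≤o⇒n≤o (N B 0<ε) (L₁ ℕ.⊔ L₂) h)
    L₂≤ : ∀ {m} → K ℕ.≤ m → L₂ ℕ.≤ m
    L₂≤ h = ℕ.m⊔n≤o⇒n≤o L₁ L₂ (ℕ.m⊔n≤o⇒n≤o (N B 0<ε) (L₁ ℕ.⊔ L₂) h)
    x≤B : ∀ {m} → K ℕ.≤ m → seq x m ≤ B
    x≤B {m} m≥ = ≤-trans (p≤∣p∣ (seq x m)) (proj₂ (proj₂ (proj₂ (bounded x))) (L₁≤ m≥))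
    near : ∀ {m n} → K ℕ.≤ m → K ℕ.≤ n → seq x m ≤ seq x n + δ B 0<ε * ½
    near m≥ n≥ = ≤+∣-∣ (proj₂ (isCauchy x (0<½ (0<δ B 0<ε))) (L₂≤ m≥) (L₂≤ n≥))

-- If the f m converge to F, this is max {y ≥ 0 | F y ≤ x} for x ≥ F 0, and 0 otherwise.
inverse : (f : ℕ → ℚ → ℚ) → Invertible f → ℝ → ℝ
inverse f inv x = mkℝ (λ m → inverseApprox f m (seq x m)) (Inverse.inverse-isCauchy inv x)

sq-expand : ∀ {a b ε} → 0ℚ ≤ ε → 0ℚ ≤ a → a + ε ≤ b → a * a + ε * ε ≤ b * b
sq-expand {a} {b} {ε} 0≤ε 0≤a h = begin
  a * a + ε * ε             ≡⟨ +-identityʳ (a * a + ε * ε) ⟨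
  a * a + ε * ε + 0ℚ        ≤⟨ +-monoʳ-≤ (a * a + ε * ε) (0≤+ (0≤* 0≤a 0≤ε) (0≤* 0≤a 0≤ε)) ⟩
  a * a + ε * ε + (a * ε + a * ε)
    ≡⟨ solve 2 (λ a e → a :* a :+ e :* e :+ (a :* e :+ a :* e) := (a :+ e) :* (a :+ e)) refl a ε ⟩
  (a + ε) * (a + ε)         ≤⟨ *-mono (≤-trans (0≤+ 0≤a 0≤ε) h) (0≤+ 0≤a 0≤ε) h h ⟩
  b * b                     ∎
  where open ≤-Reasoning

1≤∣B∣+1 : ∀ B → 1ℚ ≤ ∣ B ∣ + 1ℚ
1≤∣B∣+1 B = subst (_≤ ∣ B ∣ + 1ℚ) (+-identityˡ 1ℚ) (+-monoˡ-≤ 1ℚ (0≤∣p∣ B))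

B<∣B∣+1 : ∀ B → B < ∣ B ∣ + 1ℚ
B<∣B∣+1 B = ≤-<-trans (p≤∣p∣ B) (subst (_< ∣ B ∣ + 1ℚ) (+-identityʳ ∣ B ∣)
  (+-monoʳ-< ∣ B ∣ (positive⁻¹ 1ℚ)))

0<∣B∣+1 : ∀ B → 0ℚ < ∣ B ∣ + 1ℚ
0<∣B∣+1 B = <-≤-trans (positive⁻¹ 1ℚ) (1≤∣B∣+1 B)

y≤y² : ∀ {y} → 1ℚ ≤ y → y ≤ y * y
y≤y² {y} 1≤y = subst (_≤ y * y) (*-identityˡ y)
  (*-monoˡ y (≤-trans (<⇒≤ (positive⁻¹ 1ℚ)) 1≤y) 1≤y)

square-invertible : Invertible (λ _ a → a * a)
square-invertible = record
  { uniform   = λ _ {ε} 0<ε → 0 , λ {_} {_} {a} _ _ _ _ →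
      subst (_≤ a * a + ε) (+-identityʳ (a * a)) (+-monoʳ-≤ (a * a) (<⇒≤ 0<ε))
  ; expansive = λ {ε} 0<ε → ε * ε , 0<* 0<ε 0<ε , 0 , λ _ → sq-expand (<⇒≤ 0<ε)
  ; unbounded = λ B → ∣ B ∣ + 1ℚ , 0<∣B∣+1 B , 0 , λ _ h →
      <-≤-trans (B<∣B∣+1 B) (≤-trans h (y≤y² (≤-trans (1≤∣B∣+1 B) h)))
  }

exp-expand : ∀ k {a b ε} → 0ℚ ≤ a → 0ℚ ≤ ε → a + ε ≤ b →
             expSum (2 ℕ.+ k) a + ε ≤ expSum (2 ℕ.+ k) b
exp-expand zero {a} {b} {ε} 0≤a 0≤ε h = subst₂ _≤_ (two a ε) (one b) (+-monoʳ-≤ 1ℚ h)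
  where
  two : ∀ a ε → 1ℚ + (a + ε) ≡ 0ℚ + 1ℚ + 1ℚ * (a * 1ℚ) + ε
  two = solve 2 (λ a e → con 1ℚ :+ (a :+ e) :=
          con 0ℚ :+ con 1ℚ :+ con 1ℚ :* (a :* con 1ℚ) :+ e) refl
  one : ∀ b → 1ℚ + b ≡ 0ℚ + 1ℚ + 1ℚ * (b * 1ℚ)
  one = solve 1 (λ b → con 1ℚ :+ b := con 0ℚ :+ con 1ℚ :+ con 1ℚ :* (b :* con 1ℚ)) refl
exp-expand (suc k) {a} {b} {ε} 0≤a 0≤ε h = subst (_≤ expSum (3 ℕ.+ k) b)
  (swap (expSum (2 ℕ.+ k) a) ε (expTerm (2 ℕ.+ k) a))
  (+-mono-≤ (exp-expand k 0≤a 0≤ε h) (expTerm-mono (2 ℕ.+ k) 0≤a a≤b))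
  where
  swap : ∀ p q r → p + q + r ≡ p + r + q
  swap = solve 3 (λ p q r → p :+ q :+ r := p :+ r :+ q) refl
  a≤b : a ≤ b
  a≤b = ≤-trans (subst (_≤ a + ε) (+-identityʳ a) (+-monoʳ-≤ a 0≤ε)) h

0≤expSum : ∀ m {a} → 0ℚ ≤ a → 0ℚ ≤ expSum m a
0≤expSum zero    0≤a = ≤-refl
0≤expSum (suc m) 0≤a = 0≤+ (0≤expSum m 0≤a) (0≤expTerm m 0≤a)

y≤expSum : ∀ k {y} → 0ℚ ≤ y → y ≤ expSum (2 ℕ.+ k) y
y≤expSum k {y} 0≤y = begin
  y                          ≡⟨ +-identityˡ y ⟨
  0ℚ + y                     ≤⟨ +-monoˡ-≤ y (0≤expSum (2 ℕ.+ k) ≤-refl) ⟩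
  expSum (2 ℕ.+ k) 0ℚ + y    ≤⟨ exp-expand k ≤-refl 0≤y (≤-reflexive (+-identityˡ y)) ⟩
  expSum (2 ℕ.+ k) y         ∎
  where open ≤-Reasoning

exp-uniform : ∀ B {ε} → 0ℚ < ε → ∃[ N ]
  (∀ {m n a} → N ℕ.≤ m → N ℕ.≤ n → 0ℚ ≤ a → a ≤ B → expSum m a ≤ expSum n a + ε)
exp-uniform B 0<ε = proj₁ u , λ m≥ n≥ 0≤a a≤B →
  ≤+∣-∣ (proj₂ (proj₂ u) (subst (_≤ ∣ B ∣) (sym (0≤p⇒∣p∣≡p 0≤a))
    (≤-trans a≤B (p≤∣p∣ B))) m≥ n≥)
  where u = Tail.expSum-uniform (0≤∣p∣ B) 0<ε

exp-expansive : ∀ {ε} → 0ℚ < ε → ∀ {m a b} → 2 ℕ.≤ m → 0ℚ ≤ a → a + ε ≤ b →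
                expSum m a + ε ≤ expSum m b
exp-expansive 0<ε {suc (suc k)} (ℕ.s≤s (ℕ.s≤s _)) 0≤a h = exp-expand k 0≤a (<⇒≤ 0<ε) h

exp-unbounded : ∀ B {m y} → 2 ℕ.≤ m → ∣ B ∣ + 1ℚ ≤ y → B < expSum m y
exp-unbounded B {suc (suc k)} (ℕ.s≤s (ℕ.s≤s _)) h =
  <-≤-trans (B<∣B∣+1 B) (≤-trans h (y≤expSum k (≤-trans (<⇒≤ (0<∣B∣+1 B)) h)))

exp-invertible : Invertible expSum
exp-invertible = record
  { uniform   = exp-uniform
  ; expansive = λ {ε} 0<ε → ε , 0<ε , 2 , exp-expansive 0<ε
  ; unbounded = λ B → ∣ B ∣ + 1ℚ , 0<∣B∣+1 B , 2 , exp-unbounded B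
  }

infix 9 √_

-- The square root of x ≥ 0; 0 for x ≤ 0.
√_ : ℝ → ℝ
√_ = inverse (λ _ a → a * a) square-invertible

-- The natural logarithm of x ≥ 1; 0 for x ≤ 1.
log : ℝ → ℝ
log = inverse expSum exp-invertible

------------------------------------------------------------------------
-- The cup game

-- The player's past selections, most recent first. Everything else that
-- has happened is determined by the adversary's strategy.
History : ℕ → Set
History n = List (Fin n)

Σᴿ : ∀ {n} → Vector ℝ n → ℝ
Σᴿ = Vector.foldr _+ᴿ_ 0ᴿ

module _ {n : ℕ} (pour : History n → Vector ℝ n) where

  mutual

    heights : History n → Vector ℝ n
    heights []      = Vector.replicate n 0ᴿ
    heights (i ∷ h) = Vector.updateAt (filled h) i (const 0ᴿ)

    -- The intermediate heights g₁, …, gₙ, before the player's move.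
    filled : History n → Vector ℝ n
    filled h = Vector.zipWith _+ᴿ_ (heights h) (pour h)

record Adversary (n : ℕ) (c : ℝ) : Set where
  field
    pour           : History n → Vector ℝ n
    estimate       : History n → Vector ℝ n
    pour-nonneg    : ∀ h i → 0ᴿ ≤ᴿ pour h i
    pour-total     : ∀ h → Σᴿ (pour h) ≃ᴿ 1ᴿ
    estimate-lower : ∀ h i → filled pour h i ≤ᴿ estimate h i
    estimate-upper : ∀ h i → estimate h i ≤ᴿ c *ᴿ filled pour h i

-- Which selections a player may make when shown the given estimates.
PlayerRule : Set₁
PlayerRule = ∀ {n} → Vector ℝ n → Fin n → Set

Greedy : PlayerRule
Greedy g′ i = ∀ j → g′ j ≤ᴿ g′ i

data Play (R : PlayerRule) {n c} (σ : Adversary n c) : History n → Set where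
  []  : Play R σ []
  _∷_ : ∀ {h i} → R (Adversary.estimate σ h) i → Play R σ h → Play R σ (i ∷ h)

-- B bounds every height at every moment, for every adversary and every
-- choice left open by R; equivalently, the supremum of these heights is ≤ B.
WorstCaseBacklog≤ : PlayerRule → (n : ℕ) (c B : ℝ) → Set
WorstCaseBacklog≤ R n c B =
  (σ : Adversary n c) → let open Adversary σ in
  ∀ {h} → Play R σ h → ∀ i → heights pour h i ≤ᴿ B × filled pour h i ≤ᴿ B

{-# OPTIONS --safe #-}
module Submission where

-- At a fixed index m the approximating sequences of all heights form a game
-- with rational heights y, in which at most 2 units are poured per step and the
-- cup that is emptied has height at least about 1/k of the maximum, where c ≤ k.
-- Let E a = Σⱼ (yⱼ - a)⁺ and b ≥ 2ka + 1. A step that empties a cup higher than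
-- 2a lowers E a by a, less what is poured, which for 2l + 2 ≤ a pays for the
-- growth of l·E b; and after a step that empties a lower cup no height exceeds
-- b, so E b = 0. Hence a bound on E a at all times is one on l·E b as well. With
-- aₛ = 4Kˢ and l = Kˢ, the bound E 4 ≤ nK at level 0 becomes K^(s(s-1)/2)·E aₛ ≤ nK,
-- so once K^(s(s-1)/2) ≥ n no height exceeds aₛ + K. Thus s = O(√log n) levels
-- suffice, and the backlog is K^O(s).

open import Defs
open import Data.Fin as Fin using (Fin; zero; suc)
import Data.Fin.Properties as Fin
open import Data.Nat as ℕ using (ℕ; zero; suc; _≤_)
import Data.Nat.Properties as ℕ
open import Data.Nat.Tactic.RingSolver using (solve-∀)
open import Data.Product using (∃-syntax; _×_; _,_; proj₁; proj₂)
open import Data.Rational renaming (_≤_ to _≤ℚ_)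
open import Data.Rational.Properties
open import Data.Rational.Solver using (module +-*-Solver)
open import Data.Sum using ([_,_]′)
open import Data.Vec.Functional as Vector using (Vector)
open import Data.Vec.Functional.Properties using (updateAt-updates; updateAt-minimal)
open import Function using (_∘_)
open import Relation.Nullary using (yes; no; contradiction)
open import Relation.Binary.PropositionalEquality

open +-*-Solver using (solve; con; _:=_; _:+_; _:*_; _:-_)

-- Positive parts and finite sums of rationals.

infix 9 _⁺

_⁺ : ℚ → ℚ
q ⁺ = 0ℚ ⊔ q

0≤⁺ : ∀ q → 0ℚ ≤ℚ q ⁺
0≤⁺ q = p≤p⊔q 0ℚ q

≤⁺ : ∀ q → q ≤ℚ q ⁺
≤⁺ q = p≤q⊔p 0ℚ q

⁺-lub : ∀ {p q} → 0ℚ ≤ℚ q → p ≤ℚ q → p ⁺ ≤ℚ q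
⁺-lub = ⊔-lub

⁺-∸ : ∀ {q a} → q ≤ℚ a → (q - a) ⁺ ≤ℚ 0ℚ
⁺-∸ {q} {a} q≤a = ⁺-lub ≤-refl (subst (q - a ≤ℚ_) (+-inverseʳ a) (+-monoˡ-≤ (- a) q≤a))

≤+⁺ : ∀ q a → q ≤ℚ a + (q - a) ⁺
≤+⁺ q a = subst (_≤ℚ a + (q - a) ⁺) (solve 2 (λ q a → a :+ (q :- a) := q) refl q a)
  (+-monoʳ-≤ a (≤⁺ (q - a)))

⁺-shift : ∀ {r} q p a → r ≤ℚ q + p → (r - a) ⁺ ≤ℚ (q - a) ⁺ + p ⁺
⁺-shift {r} q p a r≤ = ⁺-lub (0≤+ (0≤⁺ (q - a)) (0≤⁺ p)) (begin
  r - a                ≤⟨ +-monoˡ-≤ (- a) r≤ ⟩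
  q + p - a            ≡⟨ solve 3 (λ q p a → q :+ p :- a := q :- a :+ p) refl q p a ⟩
  q - a + p            ≤⟨ +-mono-≤ (≤⁺ (q - a)) (≤⁺ p) ⟩
  (q - a) ⁺ + p ⁺      ∎)
  where open ≤-Reasoning

interchange : ∀ p q r s → (p + q) + (r + s) ≡ (p + r) + (q + s)
interchange = solve 4 (λ p q r s → (p :+ q) :+ (r :+ s) := (p :+ r) :+ (q :+ s)) refl

sum : ∀ {n} → Vector ℚ n → ℚ
sum = Vector.foldr _+_ 0ℚ

sum-const : ∀ {n} {u : Vector ℚ n} {q} → (∀ j → u j ≤ℚ q) → sum u ≤ℚ fromℕ n * q
sum-const {zero} {q = q} u≤ = ≤-reflexive (sym (*-zeroˡ q))
sum-const {suc n} {u = u} {q = q} u≤ = begin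
  u zero + sum (u ∘ suc)  ≤⟨ +-mono-≤ (u≤ zero) (sum-const (u≤ ∘ suc)) ⟩
  q + fromℕ n * q         ≡⟨ solve 2 (λ q n → q :+ n :* q := (n :+ con 1ℚ) :* q) refl q (fromℕ n) ⟩
  (fromℕ n + 1ℚ) * q      ≡⟨ cong (_* q) (fromℕ-suc n) ⟨
  fromℕ (suc n) * q       ∎
  where open ≤-Reasoning

sum-nonneg : ∀ {n} {u : Vector ℚ n} → (∀ j → 0ℚ ≤ℚ u j) → 0ℚ ≤ℚ sum u
sum-nonneg {zero}  0≤u = ≤-refl
sum-nonneg {suc n} 0≤u = 0≤+ (0≤u zero) (sum-nonneg (0≤u ∘ suc))

term≤sum : ∀ {n} {u : Vector ℚ n} → (∀ j → 0ℚ ≤ℚ u j) → ∀ i → u i ≤ℚ sum u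
term≤sum {u = u} 0≤u zero    = subst (_≤ℚ sum u) (+-identityʳ (u zero))
  (+-monoʳ-≤ (u zero) (sum-nonneg (0≤u ∘ suc)))
term≤sum {u = u} 0≤u (suc i) = subst (_≤ℚ sum u) (+-identityˡ (u (suc i)))
  (+-mono-≤ (0≤u zero) (term≤sum (0≤u ∘ suc) i))

sum-mono-+ : ∀ {n} {u v w : Vector ℚ n} → (∀ j → u j ≤ℚ v j + w j) →
             sum u ≤ℚ sum v + sum w
sum-mono-+ {zero}                  u≤ = ≤-refl
sum-mono-+ {suc n} {v = v} {w = w} u≤ = subst (_ ≤ℚ_)
  (interchange (v zero) (w zero) (sum (v ∘ suc)) (sum (w ∘ suc)))
  (+-mono-≤ (u≤ zero) (sum-mono-+ (u≤ ∘ suc)))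

-- Slack `d` in the single term `i` survives summation. In use `i` is the emptied cup and `d` what
-- emptying it removes.
sum-mono-+-gap : ∀ {n} {u v w : Vector ℚ n} i {d} → (∀ j → j ≢ i → u j ≤ℚ v j + w j) →
                 u i + d ≤ℚ v i + w i → sum u + d ≤ℚ sum v + sum w
sum-mono-+-gap {u = u} {v} {w} zero {d} u≤ gap = subst₂ _≤ℚ_
  (solve 3 (λ u s d → (u :+ d) :+ s := (u :+ s) :+ d) refl (u zero) (sum (u ∘ suc)) d)
  (interchange (v zero) (w zero) (sum (v ∘ suc)) (sum (w ∘ suc)))
  (+-mono-≤ gap (sum-mono-+ λ j → u≤ (suc j) λ ()))
sum-mono-+-gap {u = u} {v} {w} (suc i) {d} u≤ gap = subst₂ _≤ℚ_
  (sym (+-assoc (u zero) (sum (u ∘ suc)) d))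
  (interchange (v zero) (w zero) (sum (v ∘ suc)) (sum (w ∘ suc)))
  (+-mono-≤ (u≤ zero λ ())
    (sum-mono-+-gap i (λ j j≢i → u≤ (suc j) (j≢i ∘ Fin.suc-injective)) gap))

-- The game with rational heights.

2ℚ : ℚ
2ℚ = fromℕ 2

-- The 1 in the greedy condition absorbs the ε's of the comparisons of reals.
data Trace (k : ℕ) {n} : Vector ℚ n → Set where
  start : ∀ {y} → (∀ j → y j ≤ℚ 0ℚ) → Trace k y
  step  : ∀ {y p y′} i → Trace k y → sum (_⁺ ∘ p) ≤ℚ 2ℚ →
          (∀ j → y j + p j ≤ℚ fromℕ k * (y i + p i) ⁺ + 1ℚ) →
          y′ i ≤ℚ 0ℚ → (∀ j → j ≢ i → y′ j ≤ℚ y j + p j) → Trace k y′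

-- The excess over a level, and how one step changes it.

excess : ∀ {n} → ℚ → Vector ℚ n → ℚ
excess a y = sum (λ j → (y j - a) ⁺)

0≤excess : ∀ {n} a (y : Vector ℚ n) → 0ℚ ≤ℚ excess a y
0≤excess a y = sum-nonneg λ j → 0≤⁺ (y j - a)

excess-zero : ∀ {n a} {y : Vector ℚ n} → (∀ j → y j ≤ℚ a) → excess a y ≤ℚ 0ℚ
excess-zero {n} y≤a = ≤-trans (sum-const (λ j → ⁺-∸ (y≤a j))) (≤-reflexive (*-zeroʳ (fromℕ n)))

-- Positive parts are subadditive, so pouring raises the excess by at most the positive mass poured.
-- Emptying then removes the whole term of cup `i`, which is at least `d`.
excess-step : ∀ {n} a (y p : Vector ℚ n) {y′ i d} → 0ℚ ≤ℚ a → sum (_⁺ ∘ p) ≤ℚ 2ℚ →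
              y′ i ≤ℚ 0ℚ → (∀ j → j ≢ i → y′ j ≤ℚ y j + p j) →
              d ≤ℚ (y i + p i - a) ⁺ → excess a y′ + d ≤ℚ excess a y + 2ℚ
excess-step a y p {y′} {i} {d} 0≤a Σp≤ emptied kept d≤ = ≤-trans
  (sum-mono-+-gap i (λ j j≢i → ⁺-shift (y j) (p j) a (kept j j≢i)) gap)
  (+-monoʳ-≤ (excess a y) Σp≤)
  where
  open ≤-Reasoning
  gap : (y′ i - a) ⁺ + d ≤ℚ (y i - a) ⁺ + (p i) ⁺
  gap = begin
    (y′ i - a) ⁺ + d            ≤⟨ +-mono-≤ (⁺-∸ (≤-trans emptied 0≤a)) d≤ ⟩
    0ℚ + (y i + p i - a) ⁺      ≡⟨ +-identityˡ _ ⟩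
    (y i + p i - a) ⁺           ≤⟨ ⁺-shift (y i) (p i) a ≤-refl ⟩
    (y i - a) ⁺ + (p i) ⁺       ∎

-- For steps that empty a low cup: the greedy choice carries the bound on that one cup over to all
-- cups, so nothing exceeds the next level `b`.
greedy-quiet : ∀ {n k i x b} {z : Vector ℚ n} → 0ℚ ≤ℚ x → z i ≤ℚ x →
               fromℕ k * x + 1ℚ ≤ℚ b → (∀ j → z j ≤ℚ fromℕ k * z i ⁺ + 1ℚ) → ∀ j → z j ≤ℚ b
greedy-quiet {k = k} 0≤x zᵢ≤x ≤b greedy j = ≤-trans (greedy j)
  (≤-trans (+-monoˡ-≤ 1ℚ (*-monoʳ (fromℕ k) (0≤fromℕ k) (⁺-lub 0≤x zᵢ≤x))) ≤b)

after-emptying : ∀ {n b i} {z y′ : Vector ℚ n} → 0ℚ ≤ℚ b → (∀ j → z j ≤ℚ b) →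
                 y′ i ≤ℚ 0ℚ → (∀ j → j ≢ i → y′ j ≤ℚ z j) → ∀ j → y′ j ≤ℚ b
after-emptying {i = i} 0≤b z≤b emptied kept j with j Fin.≟ i
... | yes refl = ≤-trans emptied 0≤b
... | no j≢i   = ≤-trans (kept j j≢i) (z≤b j)

gap-⁺ : ∀ z a {d} → a + d ≤ℚ z → d ≤ℚ (z - a) ⁺
gap-⁺ z a {d} h = ≤-trans
  (subst (_≤ℚ z - a) (solve 2 (λ a d → a :+ d :- a := d) refl a d) (+-monoˡ-≤ (- a) h))
  (≤⁺ (z - a))

+-cancelʳ-≤ : ∀ {p q} r → p + r ≤ℚ q + r → p ≤ℚ q
+-cancelʳ-≤ {p} {q} r h = 0≤-⇒≤ (subst (0ℚ ≤ℚ_)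
  (solve 3 (λ p q r → q :+ r :- (p :+ r) := q :- p) refl p q r) (≤⇒0≤- h))

-- If the emptied cup is above `a + 2ℚ`, at least 2 is removed, which pays for the pour, and the
-- bound is inherited. Otherwise every height is at most `b`, and the `n` terms are bounded one by
-- one.
excess-base : ∀ {n k a b} {y : Vector ℚ n} → 0ℚ ≤ℚ a → 0ℚ ≤ℚ b →
              fromℕ k * (a + 2ℚ) + 1ℚ ≤ℚ b → Trace k y → excess a y ≤ℚ fromℕ n * b
excess-base {n} {b = b} 0≤a 0≤b ≤b (start y≤0) =
  ≤-trans (excess-zero (λ j → ≤-trans (y≤0 j) 0≤a)) (0≤* (0≤fromℕ n) 0≤b)
excess-base {a = a} {b} {y′} 0≤a 0≤b ≤b (step {y} {p} i t Σp≤ greedy emptied kept)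
  with y i + p i ≤? a + 2ℚ
... | yes zᵢ≤ = sum-const λ j → ⁺-lub 0≤b (≤-trans
      (+-monoʳ-≤ (y′ j) (neg-antimono-≤ 0≤a))
      (≤-trans (≤-reflexive (+-identityʳ (y′ j)))
        (after-emptying 0≤b (greedy-quiet (0≤+ 0≤a (nonNegative⁻¹ 2ℚ)) zᵢ≤ ≤b greedy) emptied kept j)))
... | no zᵢ≰ = ≤-trans
      (+-cancelʳ-≤ 2ℚ (excess-step a y p 0≤a Σp≤ emptied kept (gap-⁺ (y i + p i) a (<⇒≤ (≰⇒> zᵢ≰)))))
      (excess-base 0≤a 0≤b ≤b t)

-- From one level to the next.

module Level {n k} {a b l w G : ℚ} (0≤l : 0ℚ ≤ℚ l) (0≤w : 0ℚ ≤ℚ w)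
  (2l+2≤a : l * 2ℚ + 2ℚ ≤ℚ a) (≤b : fromℕ k * (a + a) + 1ℚ ≤ℚ b)
  (bound : ∀ {y : Vector ℚ n} → Trace k y → w * excess a y ≤ℚ G) where

  open ≤-Reasoning

  0≤a : 0ℚ ≤ℚ a
  0≤a = ≤-trans (0≤+ (0≤* 0≤l (nonNegative⁻¹ 2ℚ)) (nonNegative⁻¹ 2ℚ)) 2l+2≤a

  0≤b : 0ℚ ≤ℚ b
  0≤b = ≤-trans (0≤+ (0≤* (0≤fromℕ k) (0≤+ 0≤a 0≤a)) (nonNegative⁻¹ 1ℚ)) ≤b

  -- The two excesses are tracked together so that a fall of the lower one can pay for a rise of the
  -- upper one. The bounds have the form `w` times excess with `G` fixed, so that passing to the
  -- next level multiplies the weight by `l` without any division.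
  potential : Vector ℚ n → ℚ
  potential y = l * excess b y + excess a y

  quiet : ∀ {y} → Trace k y → (∀ j → y j ≤ℚ b) → w * potential y ≤ℚ G
  quiet {y} t y≤b = ≤-trans (*-monoʳ w 0≤w (begin
    l * excess b y + excess a y  ≤⟨ +-monoˡ-≤ _ (*-monoʳ l 0≤l (excess-zero y≤b)) ⟩
    l * 0ℚ + excess a y          ≡⟨ solve 2 (λ l e → l :* con 0ℚ :+ e := e) refl l (excess a y) ⟩
    excess a y                   ∎)) (bound t)

  potential-bound : ∀ {y} → Trace k y → w * potential y ≤ℚ G
  potential-bound t@(start y≤0) = quiet t λ j → ≤-trans (y≤0 j) 0≤b
  potential-bound {y′} t′@(step {y} {p} i t Σp≤ greedy emptied kept)
    with y i + p i ≤? a + a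
  -- After a low cup is emptied the excess over `b` is 0, and `bound` is applied afresh to the whole
  -- trace in place of the induction hypothesis.
  ... | yes zᵢ≤ = quiet t′
        (after-emptying 0≤b (greedy-quiet (0≤+ 0≤a 0≤a) zᵢ≤ ≤b greedy) emptied kept)
  ... | no zᵢ≰ = ≤-trans (*-monoʳ w 0≤w (+-cancelʳ-≤ a (begin
    l * excess b y′ + excess a y′ + a        ≡⟨ +-assoc (l * excess b y′) (excess a y′) a ⟩
    l * excess b y′ + (excess a y′ + a)
      ≤⟨ +-mono-≤ (*-monoʳ l 0≤l b-step) (excess-step a y p 0≤a Σp≤ emptied kept
           (gap-⁺ (y i + p i) a (<⇒≤ (≰⇒> zᵢ≰)))) ⟩
    l * (excess b y + 2ℚ) + (excess a y + 2ℚ)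
      ≡⟨ solve 4 (λ l d e t → l :* (d :+ t) :+ (e :+ t) := l :* d :+ e :+ (l :* t :+ t))
           refl l (excess b y) (excess a y) 2ℚ ⟩
    potential y + (l * 2ℚ + 2ℚ)              ≤⟨ +-monoʳ-≤ (potential y) 2l+2≤a ⟩
    potential y + a                          ∎))) (potential-bound t)
    where
    b-step : excess b y′ ≤ℚ excess b y + 2ℚ
    b-step = subst (_≤ℚ excess b y + 2ℚ) (+-identityʳ (excess b y′))
      (excess-step b y p {d = 0ℚ} 0≤b Σp≤ emptied kept (0≤⁺ (y i + p i - b)))

  next-level : ∀ {y} → Trace k y → (w * l) * excess b y ≤ℚ G
  next-level {y} t = begin
    w * l * excess b y                   ≡⟨ *-assoc w l (excess b y) ⟩
    w * (l * excess b y)                 ≡⟨ cong (w *_) (+-identityʳ (l * excess b y)) ⟨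
    w * (l * excess b y + 0ℚ)            ≤⟨ *-monoʳ w 0≤w (+-monoʳ-≤ (l * excess b y) (0≤excess a y)) ⟩
    w * potential y                      ≤⟨ potential-bound t ⟩
    G                                    ∎

-- The triangular number 0 + 1 + ... + (s - 1): the levels before `s` contribute the factors K^0,
-- ..., K^(s-1) to the weight.
tri : ℕ → ℕ
tri zero    = 0
tri (suc s) = tri s ℕ.+ s

-- Level 0 is `excess-base` with a = 4 and b = K, whence 6 = 4 + 2 in the hypothesis. The step takes
-- l = K^s and a = 4l: then 2l + 2 ≤ 4l because l ≥ 1, and 8kl + 1 ≤ 4Kl because K ≥ 6k + 1.
excess-level : ∀ {n k K} → k ℕ.* 6 ℕ.+ 1 ≤ K → ∀ s {y : Vector ℚ n} → Trace k y →
  fromℕ (K ℕ.^ tri s) * excess (fromℕ (4 ℕ.* K ℕ.^ s)) y ≤ℚ fromℕ n * fromℕ K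
excess-level {n} {k} {K} 6k+1≤K zero {y} t = ≤-trans
  (≤-reflexive (*-identityˡ (excess (fromℕ 4) y)))
  (excess-base (0≤fromℕ 4) (0≤fromℕ K) ≤K t)
  where
  ≤K : fromℕ k * fromℕ 6 + fromℕ 1 ≤ℚ fromℕ K
  ≤K = subst (_≤ℚ fromℕ K)
    (sym (trans (cong (_+ fromℕ 1) (fromℕ-* k 6)) (fromℕ-+ (k ℕ.* 6) 1)))
    (fromℕ-mono 6k+1≤K)
excess-level {n} {k} {K} 6k+1≤K (suc s) {y} t = subst
  (λ w → w * excess (fromℕ (4 ℕ.* (K ℕ.* x))) y ≤ℚ fromℕ n * fromℕ K) weight
  (Level.next-level (0≤fromℕ x) (0≤fromℕ (K ℕ.^ tri s)) 2l+2≤a ≤b (excess-level 6k+1≤K s) t)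
  where
  x : ℕ
  x = K ℕ.^ s
  1≤x : 1 ≤ x
  1≤x = ℕ.m^n>0 K {{ℕ.>-nonZero (ℕ.≤-trans (ℕ.m≤n+m 1 (k ℕ.* 6)) 6k+1≤K)}} s
  weight : fromℕ (K ℕ.^ tri s) * fromℕ x ≡ fromℕ (K ℕ.^ (tri s ℕ.+ s))
  weight = trans (fromℕ-* (K ℕ.^ tri s) x) (cong fromℕ (sym (ℕ.^-distribˡ-+-* K (tri s) s)))
  2l+2≤a : fromℕ x * 2ℚ + 2ℚ ≤ℚ fromℕ (4 ℕ.* x)
  2l+2≤a = subst (_≤ℚ fromℕ (4 ℕ.* x))
    (sym (trans (cong (_+ 2ℚ) (fromℕ-* x 2)) (fromℕ-+ (x ℕ.* 2) 2)))
    (fromℕ-mono (begin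
      x ℕ.* 2 ℕ.+ 2         ≤⟨ ℕ.+-monoʳ-≤ (x ℕ.* 2) (ℕ.*-monoˡ-≤ 2 1≤x) ⟩
      x ℕ.* 2 ℕ.+ x ℕ.* 2   ≡⟨ four x ⟩
      4 ℕ.* x               ∎))
    where
    open ℕ.≤-Reasoning
    four : ∀ x → x ℕ.* 2 ℕ.+ x ℕ.* 2 ≡ 4 ℕ.* x
    four = solve-∀
  ≤b : fromℕ k * (fromℕ (4 ℕ.* x) + fromℕ (4 ℕ.* x)) + fromℕ 1 ≤ℚ fromℕ (4 ℕ.* (K ℕ.* x))
  ≤b = subst (_≤ℚ fromℕ (4 ℕ.* (K ℕ.* x))) (sym (trans
      (cong (λ q → fromℕ k * q + fromℕ 1) (fromℕ-+ (4 ℕ.* x) (4 ℕ.* x)))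
      (trans (cong (_+ fromℕ 1) (fromℕ-* k (4 ℕ.* x ℕ.+ 4 ℕ.* x)))
        (fromℕ-+ (k ℕ.* (4 ℕ.* x ℕ.+ 4 ℕ.* x)) 1))))
    (fromℕ-mono (begin
      k ℕ.* (4 ℕ.* x ℕ.+ 4 ℕ.* x) ℕ.+ 1
        ≤⟨ ℕ.+-mono-≤ (ℕ.m≤m+n _ (k ℕ.* (16 ℕ.* x))) (ℕ.≤-trans 1≤x (ℕ.m≤m+n x (3 ℕ.* x))) ⟩
      k ℕ.* (4 ℕ.* x ℕ.+ 4 ℕ.* x) ℕ.+ k ℕ.* (16 ℕ.* x) ℕ.+ 4 ℕ.* x
        ≡⟨ regroup k x ⟩
      4 ℕ.* ((k ℕ.* 6 ℕ.+ 1) ℕ.* x)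
        ≤⟨ ℕ.*-monoʳ-≤ 4 (ℕ.*-monoˡ-≤ x 6k+1≤K) ⟩
      4 ℕ.* (K ℕ.* x) ∎))
    where
    open ℕ.≤-Reasoning
    regroup : ∀ k x → k ℕ.* (4 ℕ.* x ℕ.+ 4 ℕ.* x) ℕ.+ k ℕ.* (16 ℕ.* x) ℕ.+ 4 ℕ.* x
                    ≡ 4 ℕ.* ((k ℕ.* 6 ℕ.+ 1) ℕ.* x)
    regroup = solve-∀

-- A weight of at least `n` cancels the factor `n`, leaving a total excess of at most `K`, hence
-- heights of at most 4K^s + K. The added `2ℚ` leaves room for one more pour, as needed for the
-- intermediate heights.
trace-bound : ∀ {n k K} → 4 ≤ K → k ℕ.* 6 ℕ.+ 1 ≤ K → ∀ s → n ≤ K ℕ.^ tri s →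
  ∀ {y : Vector ℚ n} → Trace k y → ∀ j → y j + 2ℚ ≤ℚ fromℕ (K ℕ.^ (2 ℕ.+ s))
trace-bound {n} {k} {K} 4≤K 6k+1≤K s n≤W {y} t j = begin
  y j + 2ℚ                                 ≤⟨ +-monoˡ-≤ 2ℚ (≤+⁺ (y j) a) ⟩
  a + (y j - a) ⁺ + 2ℚ
    ≤⟨ +-monoˡ-≤ 2ℚ (+-monoʳ-≤ a (≤-trans (term≤sum (λ j → 0≤⁺ (y j - a)) j) excess≤K)) ⟩
  a + fromℕ K + 2ℚ
    ≡⟨ trans (cong (_+ 2ℚ) (fromℕ-+ (4 ℕ.* x) K)) (fromℕ-+ (4 ℕ.* x ℕ.+ K) 2) ⟩
  fromℕ (4 ℕ.* x ℕ.+ K ℕ.+ 2)              ≤⟨ fromℕ-mono total ⟩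
  fromℕ (K ℕ.^ (2 ℕ.+ s))                  ∎
  where
  open ≤-Reasoning
  x W : ℕ
  x = K ℕ.^ s
  W = K ℕ.^ tri s
  a : ℚ
  a = fromℕ (4 ℕ.* x)
  instance
    K≢0 : ℕ.NonZero K
    K≢0 = ℕ.>-nonZero (ℕ.≤-trans (ℕ.s≤s ℕ.z≤n) 4≤K)
  0<W : 0ℚ < fromℕ W
  0<W = <-≤-trans (positive⁻¹ 1ℚ) (fromℕ-mono {1} {W} (ℕ.m^n>0 K (tri s)))
  excess≤K : excess a y ≤ℚ fromℕ K
  excess≤K = *-cancelˡ-≤-pos (fromℕ W) {{positive 0<W}}
    (≤-trans (excess-level 6k+1≤K s t) (*-monoˡ (fromℕ K) (0≤fromℕ K) (fromℕ-mono n≤W)))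
  K≤Kx : K ≤ K ℕ.* x
  K≤Kx = ℕ.m≤m*n K x {{ℕ.>-nonZero (ℕ.m^n>0 K s)}}
  total : 4 ℕ.* x ℕ.+ K ℕ.+ 2 ≤ K ℕ.* (K ℕ.* x)
  total = ℕ.≤-trans
    (ℕ.+-mono-≤ (ℕ.+-mono-≤ (ℕ.*-monoˡ-≤ x 4≤K) K≤Kx)
      (ℕ.≤-trans (ℕ.≤-trans (ℕ.s≤s (ℕ.s≤s ℕ.z≤n)) 4≤K) K≤Kx))
    (ℕ.≤-trans (ℕ.≤-trans (ℕ.m≤m+n _ (K ℕ.* x)) (ℕ.≤-reflexive (four (K ℕ.* x))))
      (ℕ.*-monoˡ-≤ (K ℕ.* x) 4≤K))
    where
    four : ∀ u → u ℕ.+ u ℕ.+ u ℕ.+ u ≡ 4 ℕ.* u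
    four = solve-∀

-- Bounds for the partial sums of the exponential series.

expSum-mono : ∀ m {a b} → 0ℚ ≤ℚ a → a ≤ℚ b → expSum m a ≤ℚ expSum m b
expSum-mono zero    0≤a a≤b = ≤-refl
expSum-mono (suc m) 0≤a a≤b = +-mono-≤ (expSum-mono m 0≤a a≤b) (expTerm-mono m 0≤a a≤b)

-- Over a step of length ½ the increment is at most half the new value, as exp′ = exp.
expSum-half-step : ∀ m {a} → 0ℚ ≤ℚ a → expSum m (a + ½) ≤ℚ expSum m a * 2ℚ
expSum-half-step zero    {a} 0≤a = ≤-refl
expSum-half-step (suc m) {a} 0≤a = 0≤-⇒≤ (subst (0ℚ ≤ℚ_)
  (solve 2 (λ x y → (x :+ y :* con ½ :- y) :* con 2ℚ := x :* con 2ℚ :- y) refl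
    (expSum (suc m) a) (expSum (suc m) b))
  (0≤* (≤⇒0≤- increment) (nonNegative⁻¹ 2ℚ)))
  where
  b : ℚ
  b = a + ½
  0≤b : 0ℚ ≤ℚ b
  0≤b = 0≤+ 0≤a (nonNegative⁻¹ ½)
  a≤b : a ≤ℚ b
  a≤b = subst (_≤ℚ b) (+-identityʳ a) (+-monoʳ-≤ a (nonNegative⁻¹ ½))
  open ≤-Reasoning
  increment : expSum (suc m) b ≤ℚ expSum (suc m) a + expSum (suc m) b * ½
  increment = ≤+∣-∣ (begin
    ∣ expSum (suc m) b - expSum (suc m) a ∣
      ≤⟨ Tail.expSum-lipschitz 0≤b m (≤-reflexive (0≤p⇒∣p∣≡p 0≤b))
           (≤-trans (≤-reflexive (0≤p⇒∣p∣≡p 0≤a)) a≤b) ⟩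
    expSum m b * ∣ b - a ∣
      ≡⟨ cong (λ q → expSum m b * ∣ q ∣) (solve 1 (λ a → a :+ con ½ :- a := con ½) refl a) ⟩
    expSum m b * ½
      ≤⟨ *-monoˡ ½ (nonNegative⁻¹ ½) (subst (_≤ℚ expSum (suc m) b) (+-identityʳ (expSum m b))
           (+-monoʳ-≤ (expSum m b) (0≤expTerm m 0≤b))) ⟩
    expSum (suc m) b * ½ ∎)

-- Two half steps make a unit, and each at most doubles the sum. This upper bound for exp gives the
-- lower bound for `log`.
expSum≤4^ : ∀ m q → expSum m (fromℕ q) ≤ℚ fromℕ (4 ℕ.^ q)
expSum≤4^ zero    zero    = 0≤fromℕ 1
expSum≤4^ (suc m) zero    = expSum0≤1 m
  where
  expSum0≤1 : ∀ m → expSum (suc m) 0ℚ ≤ℚ 1ℚ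
  expSum0≤1 zero    = ≤-refl
  expSum0≤1 (suc m) = ≤-trans (≤-reflexive (trans
    (cong (expSum (suc m) 0ℚ +_) (trans
      (cong (expTerm m 0ℚ *_) (*-zeroˡ (1/suc m))) (*-zeroʳ (expTerm m 0ℚ))))
    (+-identityʳ (expSum (suc m) 0ℚ)))) (expSum0≤1 m)
expSum≤4^ m       (suc q) = begin
  expSum m (fromℕ (suc q))            ≡⟨ cong (expSum m) (fromℕ-suc q) ⟩
  expSum m (fromℕ q + 1ℚ)             ≡⟨ cong (expSum m) (+-assoc (fromℕ q) ½ ½) ⟨
  expSum m (fromℕ q + ½ + ½)          ≤⟨ expSum-half-step m (0≤+ (0≤fromℕ q) (nonNegative⁻¹ ½)) ⟩
  expSum m (fromℕ q + ½) * 2ℚ         ≤⟨ *-monoˡ 2ℚ (nonNegative⁻¹ 2ℚ) (expSum-half-step m (0≤fromℕ q)) ⟩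
  expSum m (fromℕ q) * 2ℚ * 2ℚ        ≤⟨ *-monoˡ 2ℚ (nonNegative⁻¹ 2ℚ)
                                           (*-monoˡ 2ℚ (nonNegative⁻¹ 2ℚ) (expSum≤4^ m q)) ⟩
  fromℕ (4 ℕ.^ q) * 2ℚ * 2ℚ           ≡⟨ solve 1 (λ x → x :* con 2ℚ :* con 2ℚ := con (fromℕ 4) :* x)
                                           refl (fromℕ (4 ℕ.^ q)) ⟩
  fromℕ 4 * fromℕ (4 ℕ.^ q)           ≡⟨ fromℕ-* 4 (4 ℕ.^ q) ⟩
  fromℕ (4 ℕ.^ suc q)                 ∎
  where open ≤-Reasoning

-- The left side consists of two terms of the binomial expansion of (a + 1)^(k+1) / (k+1)!.
expTerm-unit-step : ∀ k {a} → 0ℚ ≤ℚ a →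
                    expTerm k a + expTerm (suc k) a ≤ℚ expTerm (suc k) (a + 1ℚ)
expTerm-unit-step zero    {a} 0≤a = ≤-reflexive (solve 1 (λ a →
  con 1ℚ :+ con 1ℚ :* (a :* con 1ℚ) := con 1ℚ :* ((a :+ con 1ℚ) :* con 1ℚ)) refl a)
expTerm-unit-step (suc k) {a} 0≤a = begin
  u + u * (a * r)
    ≡⟨ cong (_+ u * (a * r)) (trans (cong (u *_) (suc*1/suc (suc k))) (*-identityʳ u)) ⟨
  u * (fromℕ (2 ℕ.+ k) * r) + u * (a * r)
    ≡⟨ cong (λ q → u * (q * r) + u * (a * r)) (fromℕ-suc (suc k)) ⟩
  u * ((s + 1ℚ) * r) + u * (a * r)
    ≡⟨ +-identityʳ _ ⟨
  u * ((s + 1ℚ) * r) + u * (a * r) + 0ℚ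
    -- The term `t * r` is exactly what (t + u)(a + 1)r has beyond the left side, in view of
    -- `us≡ta`.
    ≤⟨ +-monoʳ-≤ (u * ((s + 1ℚ) * r) + u * (a * r))
         (0≤* (0≤expTerm k 0≤a) (0≤1/suc (suc k))) ⟩
  u * ((s + 1ℚ) * r) + u * (a * r) + t * r
    ≡⟨ solve 5 (λ u s r a t → u :* ((s :+ con 1ℚ) :* r) :+ u :* (a :* r) :+ t :* r
         := (u :* s :+ t :+ u :* (a :+ con 1ℚ)) :* r) refl u s r a t ⟩
  (u * s + t + u * (a + 1ℚ)) * r
    ≡⟨ cong (λ q → (q + t + u * (a + 1ℚ)) * r) us≡ta ⟩
  (t * a + t + u * (a + 1ℚ)) * r
    ≡⟨ solve 4 (λ u r a t → (t :* a :+ t :+ u :* (a :+ con 1ℚ)) :* r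
         := (t :+ u) :* ((a :+ con 1ℚ) :* r)) refl u r a t ⟩
  (t + u) * ((a + 1ℚ) * r)
    ≤⟨ *-monoˡ ((a + 1ℚ) * r) (0≤* (0≤+ 0≤a (nonNegative⁻¹ 1ℚ)) (0≤1/suc (suc k)))
         (expTerm-unit-step k 0≤a) ⟩
  expTerm (suc k) (a + 1ℚ) * ((a + 1ℚ) * r) ∎
  where
  open ≤-Reasoning
  r s t u : ℚ
  r = 1/suc (suc k)
  s = fromℕ (suc k)
  t = expTerm k a
  u = expTerm (suc k) a
  us≡ta : u * s ≡ t * a
  us≡ta = trans
    (solve 4 (λ t a q s → t :* (a :* q) :* s := t :* a :* (s :* q)) refl t a (1/suc k) s)
    (trans (cong (t * a *_) (suc*1/suc k)) (*-identityʳ (t * a)))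

-- A truncated form of 2 exp a ≤ exp (a + 1).
expSum-unit-step : ∀ m {a} → 0ℚ ≤ℚ a →
                   expSum m a + expSum (suc m) a ≤ℚ expSum (suc m) (a + 1ℚ)
expSum-unit-step zero    0≤a = ≤-refl
expSum-unit-step (suc m) {a} 0≤a = subst (_≤ℚ expSum (2 ℕ.+ m) (a + 1ℚ))
  (interchange (expSum m a) (expSum (suc m) a) (expTerm m a) (expTerm (suc m) a))
  (+-mono-≤ (expSum-unit-step m 0≤a) (expTerm-unit-step m 0≤a))

-- Each unit step doubles the value and uses up one term of the series, so `m` must exceed `q`.
2^≤expSum : ∀ q {m} → q ℕ.< m → fromℕ (2 ℕ.^ q) ≤ℚ expSum m (fromℕ q)
2^≤expSum zero    {suc zero}    q<m = ≤-refl
2^≤expSum zero    {suc (suc m)} q<m = subst (_≤ℚ expSum (2 ℕ.+ m) 0ℚ) (+-identityʳ 1ℚ)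
  (+-mono-≤ (2^≤expSum zero {suc m} (ℕ.s≤s ℕ.z≤n)) (0≤expTerm (suc m) ≤-refl))
2^≤expSum (suc q) {suc m} (ℕ.s≤s q<m) = begin
  fromℕ (2 ℕ.^ suc q)                              ≡⟨ cong (λ x → fromℕ (2 ℕ.^ q ℕ.+ x)) (ℕ.+-identityʳ (2 ℕ.^ q)) ⟩
  fromℕ (2 ℕ.^ q ℕ.+ 2 ℕ.^ q)                      ≡⟨ fromℕ-+ (2 ℕ.^ q) (2 ℕ.^ q) ⟨
  fromℕ (2 ℕ.^ q) + fromℕ (2 ℕ.^ q)                ≤⟨ +-mono-≤ (2^≤expSum q q<m) (2^≤expSum q (ℕ.m≤n⇒m≤1+n q<m)) ⟩
  expSum m (fromℕ q) + expSum (suc m) (fromℕ q)    ≤⟨ expSum-unit-step m (0≤fromℕ q) ⟩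
  expSum (suc m) (fromℕ q + 1ℚ)                    ≡⟨ cong (expSum (suc m)) (fromℕ-suc q) ⟨
  expSum (suc m) (fromℕ (suc q))                   ∎
  where open ≤-Reasoning

-- Lower bounds for approximate inverses, and growth of the exponents.

-- If the search stopped at r < a, it would be at the top m + 1 of the grid, which exceeds `a`, or
-- the next grid point would have a value above `q`. That point is at most a + 1, as grid steps are
-- at most 1; hence the loss of 1 in the argument.
inverseApprox-≥ : ∀ {f m} a {q} → (∀ {x y} → 0ℚ ≤ℚ x → x ≤ℚ y → f m x ≤ℚ f m y) →
                  a ≤ m → f m (fromℕ (suc a)) ≤ℚ q → fromℕ a ≤ℚ inverseApprox f m q
inverseApprox-≥ {f} {m} a {q} mono a≤m f≤q = ≮⇒≥ λ r<a →
  [ (λ r≡ → ≤⇒≯ (fromℕ-mono (ℕ.m≤n⇒m≤1+n a≤m)) (subst (_< fromℕ a) r≡ r<a))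
  , ≤⇒≯ (≤-trans (mono (0≤+ nonneg (0≤1/suc m))
      (subst (r + 1/suc m ≤ℚ_) (sym (fromℕ-suc a))
        (+-mono-≤ (<⇒≤ r<a) (1/suc-anti {0} {m} ℕ.z≤n)))) f≤q)
  ]′ upper
  where
  r : ℚ
  r = inverseApprox f m q
  open Approx (inverse-approx f m q)

square≤tri : ∀ v → v ℕ.* v ≤ tri (v ℕ.+ v)
square≤tri zero    = ℕ.z≤n
square≤tri (suc v) = begin
  suc v ℕ.* suc v                              ≤⟨ ℕ.m≤m+n _ (2 ℕ.* v) ⟩
  suc v ℕ.* suc v ℕ.+ 2 ℕ.* v                  ≡⟨ expand v ⟩
  v ℕ.* v ℕ.+ (v ℕ.+ v) ℕ.+ suc (v ℕ.+ v)      ≤⟨ ℕ.+-monoˡ-≤ (suc (v ℕ.+ v)) (ℕ.+-monoˡ-≤ (v ℕ.+ v) (square≤tri v)) ⟩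
  tri (2 ℕ.+ (v ℕ.+ v))                        ≡⟨ cong (tri ∘ suc) (ℕ.+-suc v v) ⟨
  tri (suc v ℕ.+ suc v)                        ∎
  where
  open ℕ.≤-Reasoning
  expand : ∀ v → suc v ℕ.* suc v ℕ.+ 2 ℕ.* v ≡ v ℕ.* v ℕ.+ (v ℕ.+ v) ℕ.+ suc (v ℕ.+ v)
  expand = solve-∀

n<4^n : ∀ n → n ℕ.< 4 ℕ.^ n
n<4^n zero    = ℕ.s≤s ℕ.z≤n
n<4^n (suc n) = begin-strict
  suc n                         ≤⟨ n<4^n n ⟩
  4 ℕ.^ n                       <⟨ ℕ.m<m*n (4 ℕ.^ n) 4 {{ℕ.>-nonZero (ℕ.m^n>0 4 n)}} (ℕ.s≤s (ℕ.s≤s ℕ.z≤n)) ⟩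
  4 ℕ.^ n ℕ.* 4                 ≡⟨ ℕ.*-comm (4 ℕ.^ n) 4 ⟩
  4 ℕ.^ suc n                   ∎
  where open ℕ.≤-Reasoning

-- Applied to `threshold`, this downward search finds an integer that stands in for the square root
-- of log n, up to constants.
bracket : ∀ (f : ℕ → ℕ) {n} → f 0 ≤ n → ∀ u → n ℕ.< f u → ∃[ v ] f v ≤ n × n ℕ.< f (suc v)
bracket f f0≤n zero    n<f = contradiction f0≤n (ℕ.<⇒≱ n<f)
bracket f {n} f0≤n (suc u) n<f with f u ℕ.≤? n
... | yes fu≤n = u , fu≤n , n<f
... | no fu≰n  = bracket f f0≤n u (ℕ.≰⇒> fu≰n)

-- Statements that hold at all large indices of the Cauchy sequences.

Eventually : (ℕ → Set) → Set
Eventually P = ∃[ N ] (∀ {m} → N ≤ m → P m)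

ev-map : ∀ {P Q : ℕ → Set} → (∀ {m} → P m → Q m) → Eventually P → Eventually Q
ev-map f (N , p) = N , f ∘ p

ev-× : ∀ {P Q : ℕ → Set} → Eventually P → Eventually Q → Eventually (λ m → P m × Q m)
ev-× (M , p) (N , q) = M ℕ.⊔ N , λ m≥ → p (ℕ.m⊔n≤o⇒m≤o M N m≥) , q (ℕ.m⊔n≤o⇒n≤o M N m≥)

ev-≤ᴿ : ∀ {x y} → Eventually (λ m → seq x m ≤ℚ seq y m) → x ≤ᴿ y
ev-≤ᴿ {y = y} e 0<ε = ev-map (λ {m} x≤y → ≤-trans x≤y
  (≤-trans (≤-reflexive (sym (+-identityʳ (seq y m)))) (+-monoʳ-≤ (seq y m) (<⇒≤ 0<ε)))) e

ev-∀ : ∀ {n} {P : Fin n → ℕ → Set} → (∀ i → Eventually (P i)) → Eventually (λ m → ∀ i → P i m)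
ev-∀ {zero}  p = 0 , λ _ ()
ev-∀ {suc n} p = ev-map (λ { (p₀ , ps) zero → p₀ ; (p₀ , ps) (suc i) → ps i })
  (ev-× (p zero) (ev-∀ (p ∘ suc)))

-- The hypothesis gives log n ≥ (w + 1)^2, then a root of at least w, then exp (Cw) ≥ 2^(Cw). Each
-- approximate inverse loses 1, whence the two successors in the exponent.
exp√log-≥ : ∀ C w {n} → 4 ℕ.^ suc (suc w ℕ.* suc w) ≤ n → Eventually λ m →
  fromℕ (2 ℕ.^ (C ℕ.* w)) ≤ℚ seq (exp (ℕ→ℝ C *ᴿ √ (log (ℕ→ℝ n)))) m
-- The index must exceed Cw for `2^≤expSum` and reach (w + 1)^2 for both inverse searches; the sum
-- does both.
exp√log-≥ C w {n} 4^≤n = suc (C ℕ.* w) ℕ.+ suc w ℕ.* suc w , λ {m} m≥ →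
  ≤-trans (2^≤expSum (C ℕ.* w) (ℕ.m+n≤o⇒m≤o _ m≥))
    (expSum-mono m (0≤fromℕ (C ℕ.* w)) (subst (_≤ℚ _) (fromℕ-* C w)
      (*-monoʳ (fromℕ C) (0≤fromℕ C) (√-≥ (ℕ.m+n≤o⇒n≤o (suc (C ℕ.* w)) m≥)))))
  where
  log-≥ : ∀ {m} → suc w ℕ.* suc w ≤ m → fromℕ (suc w ℕ.* suc w) ≤ℚ seq (log (ℕ→ℝ n)) m
  log-≥ {m} m≥ = inverseApprox-≥ {expSum} (suc w ℕ.* suc w) (expSum-mono m) m≥
    (≤-trans (expSum≤4^ m (suc (suc w ℕ.* suc w))) (fromℕ-mono 4^≤n))
  √-≥ : ∀ {m} → suc w ℕ.* suc w ≤ m → fromℕ w ≤ℚ seq (√ (log (ℕ→ℝ n))) m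
  √-≥ {m} m≥ = inverseApprox-≥ {λ _ a → a * a} w
    (λ 0≤x x≤y → *-mono (≤-trans 0≤x x≤y) 0≤x x≤y x≤y)
    (ℕ.≤-trans (ℕ.n≤1+n w) (ℕ.≤-trans (ℕ.m≤m*n (suc w) (suc w)) m≥))
    (subst (_≤ℚ seq (log (ℕ→ℝ n)) m) (sym (fromℕ-* (suc w) (suc w))) (log-≥ m≥))

-- From plays with real heights to traces with rational heights.

seq-Σᴿ : ∀ {n} (v : Vector ℝ n) m → seq (Σᴿ v) m ≡ sum (λ j → seq (v j) m)
seq-Σᴿ {zero}  v m = refl
seq-Σᴿ {suc n} v m = cong (seq (v zero) m +_) (seq-Σᴿ (v ∘ suc) m)

at : ∀ {n} → Vector ℝ n → ℕ → Vector ℚ n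
at v m j = seq (v j) m

module _ {n c} (σ : Adversary n c) where

  open Adversary σ

  -- At a finite index pours may be slightly negative and their total slightly above 1. With errors
  -- of 1/(n + 1) in the total and in each of the `n` cups, the positive mass is still at most 2.
  pour⁺≤2 : ∀ h → Eventually λ m → sum (_⁺ ∘ at (pour h) m) ≤ℚ 2ℚ
  pour⁺≤2 h = ev-map (λ {m} (total , nonneg) → bound m total nonneg)
    (ev-× (proj₁ (pour-total h) (0<1/suc n)) (ev-∀ λ j → pour-nonneg h j (0<1/suc n)))
    where
    open ≤-Reasoning
    δ : ℚ
    δ = 1/suc n
    bound : ∀ m → seq (Σᴿ (pour h)) m ≤ℚ 1ℚ + δ → (∀ j → 0ℚ ≤ℚ at (pour h) m j + δ) →
            sum (_⁺ ∘ at (pour h) m) ≤ℚ 2ℚ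
    bound m total nonneg = begin
      sum (_⁺ ∘ p)                     ≤⟨ sum-mono-+ {v = p} {w = λ _ → δ} (λ j → ⁺-lub (nonneg j) (p≤ j)) ⟩
      sum p + sum {n} (λ _ → δ)        ≤⟨ +-mono-≤ (subst (_≤ℚ 1ℚ + δ) (seq-Σᴿ (pour h) m) total)
                                            (sum-const {n} (λ _ → ≤-refl)) ⟩
      1ℚ + δ + fromℕ n * δ             ≡⟨ solve 2 (λ d n → con 1ℚ :+ d :+ n :* d := con 1ℚ :+ (n :+ con 1ℚ) :* d)
                                            refl δ (fromℕ n) ⟩
      1ℚ + (fromℕ n + 1ℚ) * δ          ≡⟨ cong (λ q → 1ℚ + q * δ) (fromℕ-suc n) ⟨
      1ℚ + fromℕ (suc n) * δ           ≡⟨ cong (1ℚ +_) (suc*1/suc n) ⟩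
      2ℚ                               ∎
      where
      p : Vector ℚ n
      p = at (pour h) m
      p≤ : ∀ j → p j ≤ℚ p j + δ
      p≤ j = subst (_≤ℚ p j + δ) (+-identityʳ (p j)) (+-monoʳ-≤ (p j) (0≤1/suc n))

  module _ {k} (0≤c≤k : Eventually λ m → 0ℚ ≤ℚ seq c m × seq c m ≤ℚ fromℕ k) where

    -- The chain from height to estimate, to the chosen estimate, to `c` times the chosen height has
    -- three comparisons, each with error 1/3. The chosen height may be negative at a finite index,
    -- so its positive part is taken before `c` is replaced by `k`.
    greedy-at : ∀ {h i} → Greedy (estimate h) i → Eventually λ m → ∀ j →
      at (filled pour h) m j ≤ℚ fromℕ k * at (filled pour h) m i ⁺ + 1ℚ
    greedy-at {h} {i} greedy = ev-∀ λ j → ev-map (λ {m} → combine m j)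
      (ev-× 0≤c≤k (ev-× (estimate-lower h j 0<⅓) (ev-× (greedy j 0<⅓) (estimate-upper h i 0<⅓))))
      where
      open ≤-Reasoning
      ⅓ : ℚ
      ⅓ = 1/suc 2
      0<⅓ : 0ℚ < ⅓
      0<⅓ = 0<1/suc 2
      z g : ∀ m → Vector ℚ n
      z = at (filled pour h)
      g = at (estimate h)
      combine : ∀ m j → (0ℚ ≤ℚ seq c m × seq c m ≤ℚ fromℕ k) ×
        (z m j ≤ℚ g m j + ⅓) × (g m j ≤ℚ g m i + ⅓) × (g m i ≤ℚ seq c m * z m i + ⅓) →
        z m j ≤ℚ fromℕ k * z m i ⁺ + 1ℚ
      combine m j ((0≤c , c≤k) , lower , chosen , upper) = begin
        z m j                             ≤⟨ lower ⟩
        g m j + ⅓                         ≤⟨ +-monoˡ-≤ ⅓ chosen ⟩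
        g m i + ⅓ + ⅓                     ≤⟨ +-monoˡ-≤ ⅓ (+-monoˡ-≤ ⅓ upper) ⟩
        seq c m * z m i + ⅓ + ⅓ + ⅓       ≡⟨ solve 1 (λ q → q :+ con ⅓ :+ con ⅓ :+ con ⅓ := q :+ con 1ℚ)
                                               refl (seq c m * z m i) ⟩
        seq c m * z m i + 1ℚ              ≤⟨ +-monoˡ-≤ 1ℚ (≤-trans (*-monoʳ (seq c m) 0≤c (≤⁺ (z m i)))
                                               (*-monoˡ (z m i ⁺) (0≤⁺ (z m i)) c≤k)) ⟩
        fromℕ k * z m i ⁺ + 1ℚ            ∎

    -- A history is finite, so the finitely many index bounds of its steps have a common one.
    trace-at : ∀ {h} → Play Greedy σ h → Eventually λ m → Trace k (at (heights pour h) m)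
    trace-at []                      = 0 , λ _ → start λ _ → ≤-refl
    trace-at (_∷_ {h} {i} greedy pl) = ev-map
      (λ {m} (t , Σp≤ , gr) → step {p = at (pour h) m} i t Σp≤ gr
        (≤-reflexive (cong (λ x → seq x m) (updateAt-updates i (filled pour h))))
        (λ j j≢i → ≤-reflexive (cong (λ x → seq x m) (updateAt-minimal j i (filled pour h) j≢i))))
      (ev-× (trace-at pl) (ev-× (pour⁺≤2 h) (greedy-at greedy)))

-- Choice of constants and conclusion.

4≤4^ : ∀ κ .{{_ : ℕ.NonZero κ}} → 4 ≤ 4 ℕ.^ κ
4≤4^ κ = ℕ.^-monoʳ-≤ 4 (ℕ.>-nonZero⁻¹ κ)

-- Allows K to be a power of 4, so that `n`, the weights and the heights are compared through
-- exponents.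
6k+1≤4^[2+k] : ∀ k → k ℕ.* 6 ℕ.+ 1 ≤ 4 ℕ.^ (2 ℕ.+ k)
6k+1≤4^[2+k] k = begin
  k ℕ.* 6 ℕ.+ 1                          ≤⟨ ℕ.m≤m+n _ (k ℕ.* 10 ℕ.+ 15) ⟩
  k ℕ.* 6 ℕ.+ 1 ℕ.+ (k ℕ.* 10 ℕ.+ 15)    ≡⟨ sixteen k ⟩
  4 ℕ.* (4 ℕ.* suc k)                    ≤⟨ ℕ.*-monoʳ-≤ 4 (ℕ.*-monoʳ-≤ 4 (n<4^n k)) ⟩
  4 ℕ.^ (2 ℕ.+ k)                        ∎
  where
  open ℕ.≤-Reasoning
  sixteen : ∀ k → k ℕ.* 6 ℕ.+ 1 ℕ.+ (k ℕ.* 10 ℕ.+ 15) ≡ 4 ℕ.* (4 ℕ.* suc k)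
  sixteen = solve-∀

-- threshold v ≤ n forces √(log n) ≥ v + 1, and n < threshold (suc v) makes
-- levels v levels suffice.
threshold levels : ℕ → ℕ
threshold v = 4 ℕ.^ suc ((2 ℕ.+ v) ℕ.* (2 ℕ.+ v))
levels v = (4 ℕ.+ v) ℕ.+ (4 ℕ.+ v)

n<threshold : ∀ n → n ℕ.< threshold n
n<threshold n = ℕ.<-≤-trans (n<4^n n) (ℕ.^-monoʳ-≤ 4 (ℕ.m≤n⇒m≤1+n
  (ℕ.≤-trans (ℕ.m≤n+m n 2) (ℕ.m≤m*n (2 ℕ.+ n) (2 ℕ.+ n)))))

threshold≤ : ∀ κ .{{_ : ℕ.NonZero κ}} v → threshold (suc v) ≤ (4 ℕ.^ κ) ℕ.^ tri (levels v)
threshold≤ κ v = begin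
  4 ℕ.^ suc ((3 ℕ.+ v) ℕ.* (3 ℕ.+ v))     ≤⟨ ℕ.^-monoʳ-≤ 4 exponent ⟩
  4 ℕ.^ (κ ℕ.* tri (levels v))            ≡⟨ ℕ.^-*-assoc 4 κ (tri (levels v)) ⟨
  (4 ℕ.^ κ) ℕ.^ tri (levels v)            ∎
  where
  open ℕ.≤-Reasoning
  next-square : ∀ v → suc ((3 ℕ.+ v) ℕ.* (3 ℕ.+ v)) ℕ.+ (v ℕ.+ v ℕ.+ 6) ≡ (4 ℕ.+ v) ℕ.* (4 ℕ.+ v)
  next-square = solve-∀
  exponent : suc ((3 ℕ.+ v) ℕ.* (3 ℕ.+ v)) ≤ κ ℕ.* tri (levels v)
  exponent = begin
    suc ((3 ℕ.+ v) ℕ.* (3 ℕ.+ v))                         ≤⟨ ℕ.m≤m+n _ (v ℕ.+ v ℕ.+ 6) ⟩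
    suc ((3 ℕ.+ v) ℕ.* (3 ℕ.+ v)) ℕ.+ (v ℕ.+ v ℕ.+ 6)     ≡⟨ next-square v ⟩
    (4 ℕ.+ v) ℕ.* (4 ℕ.+ v)                               ≤⟨ square≤tri (4 ℕ.+ v) ⟩
    tri (levels v)                                        ≤⟨ ℕ.m≤n*m (tri (levels v)) κ ⟩
    κ ℕ.* tri (levels v)                                  ∎

-- The constant 20 comes from 2κ(2 + `levels v`) = 20κ + 4κv.
top≤ : ∀ κ v → (4 ℕ.^ κ) ℕ.^ (2 ℕ.+ levels v) ≤ 2 ℕ.^ (20 ℕ.* κ ℕ.* suc v)
top≤ κ v = begin
  (4 ℕ.^ κ) ℕ.^ (2 ℕ.+ levels v)           ≡⟨ ℕ.^-*-assoc 4 κ (2 ℕ.+ levels v) ⟩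
  4 ℕ.^ (κ ℕ.* (2 ℕ.+ levels v))           ≡⟨ ℕ.^-*-assoc 2 2 (κ ℕ.* (2 ℕ.+ levels v)) ⟩
  2 ℕ.^ (2 ℕ.* (κ ℕ.* (2 ℕ.+ levels v)))   ≤⟨ ℕ.^-monoʳ-≤ 2 exponent ⟩
  2 ℕ.^ (20 ℕ.* κ ℕ.* suc v)               ∎
  where
  open ℕ.≤-Reasoning
  expand : ∀ κ v → 2 ℕ.* (κ ℕ.* (2 ℕ.+ ((4 ℕ.+ v) ℕ.+ (4 ℕ.+ v)))) ℕ.+ 16 ℕ.* κ ℕ.* v
                 ≡ 20 ℕ.* κ ℕ.* suc v
  expand = solve-∀
  exponent : 2 ℕ.* (κ ℕ.* (2 ℕ.+ levels v)) ≤ 20 ℕ.* κ ℕ.* suc v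
  exponent = subst (2 ℕ.* (κ ℕ.* (2 ℕ.+ levels v)) ≤_) (expand κ v)
    (ℕ.m≤m+n (2 ℕ.* (κ ℕ.* (2 ℕ.+ levels v))) (16 ℕ.* κ ℕ.* v))

theorem3 : (c : ℝ) → 1ᴿ <ᴿ c →
    ∃[ C ] ∃[ N ] (∀ (n : ℕ) → N ≤ n →
    WorstCaseBacklog≤ Greedy n c (exp (C *ᴿ √ (log (ℕ→ℝ n)))))
theorem3 c (ε , 0<ε , M , 1+ε≤c) = ℕ→ℝ C , threshold 0 , backlog
  where
  k κ C : ℕ
  k = proj₁ (archimedean (proj₁ (bounded c)))
  κ = 2 ℕ.+ k
  C = 20 ℕ.* κ

  0≤c≤k : Eventually λ m → 0ℚ ≤ℚ seq c m × seq c m ≤ℚ fromℕ k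
  0≤c≤k = ev-map
    (λ {m} (lower , upper) →
      ≤-trans (0≤+ (nonNegative⁻¹ 1ℚ) (<⇒≤ 0<ε)) lower ,
      ≤-trans (p≤∣p∣ (seq c m)) (≤-trans upper (proj₂ (archimedean (proj₁ (bounded c))))))
    (ev-× (M , 1+ε≤c) (proj₂ (proj₂ (bounded c))))

  backlog-at : ∀ {n} v → threshold v ≤ n → n ℕ.< threshold (suc v) →
               WorstCaseBacklog≤ Greedy n c (exp (ℕ→ℝ C *ᴿ √ (log (ℕ→ℝ n))))
  backlog-at {n} v lower upper σ {h} play i =
    ev-≤ᴿ {g i} {bound} (ev-map (λ {m} ((t , Σp≤) , E≥) →
      ≤-trans (y≤y+2 (at g m i)) (≤-trans (y+2≤ t) E≥)) facts) ,
    -- One pour adds at most 2 to a cup, which is the room left by `trace-bound`.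
    ev-≤ᴿ {g i +ᴿ p i} {bound} (ev-map (λ {m} ((t , Σp≤) , E≥) →
      ≤-trans (+-monoʳ-≤ (at g m i) (p≤2 (at p m) Σp≤)) (≤-trans (y+2≤ t) E≥)) facts)
    where
    g p : Vector ℝ n
    p = Adversary.pour σ h
    g = heights (Adversary.pour σ) h
    bound : ℝ
    bound = exp (ℕ→ℝ C *ᴿ √ (log (ℕ→ℝ n)))
    facts : Eventually λ m → (Trace k (at g m) × sum (_⁺ ∘ at p m) ≤ℚ 2ℚ)
                           × fromℕ (2 ℕ.^ (C ℕ.* suc v)) ≤ℚ seq bound m
    facts = ev-× (ev-× (trace-at σ 0≤c≤k play) (pour⁺≤2 σ h)) (exp√log-≥ C (suc v) lower)
    y+2≤ : ∀ {y : Vector ℚ n} → Trace k y → y i + 2ℚ ≤ℚ fromℕ (2 ℕ.^ (C ℕ.* suc v))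
    y+2≤ t = ≤-trans
      (trace-bound (4≤4^ κ) (6k+1≤4^[2+k] k) (levels v) (ℕ.≤-trans (ℕ.<⇒≤ upper) (threshold≤ κ v)) t i)
      (fromℕ-mono (top≤ κ v))
    y≤y+2 : ∀ q → q ≤ℚ q + 2ℚ
    y≤y+2 q = subst (_≤ℚ q + 2ℚ) (+-identityʳ q) (+-monoʳ-≤ q (nonNegative⁻¹ 2ℚ))
    p≤2 : ∀ (p : Vector ℚ n) → sum (_⁺ ∘ p) ≤ℚ 2ℚ → p i ≤ℚ 2ℚ
    p≤2 p Σp≤ = ≤-trans (≤⁺ (p i)) (≤-trans (term≤sum (λ j → 0≤⁺ (p j)) i) Σp≤)

  backlog : ∀ n → threshold 0 ≤ n → WorstCaseBacklog≤ Greedy n c (exp (ℕ→ℝ C *ᴿ √ (log (ℕ→ℝ n))))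
  backlog n N≤n = let v , lower , upper = bracket threshold N≤n n (n<threshold n)
                  in backlog-at v lower upper
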